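{- For a connected hypergraph $\mathcal{G}=(V,E)$ on $n$ vertices, $$\operatorname{diam}(\mathcal{G})\ge\frac{4}{n\,(r(\mathcal{G})-1)\,\lambda_2(L_{\mathcal{G}})}.$$
   Context: A hypergraph $\mathcal{G}=(V,E)$ has a finite vertex set $V$ and a set $E$ of subsets of $V$ (edges), each of cardinality at least $2$. The rank $r(\mathcal{G})$ is the maximum edge cardinality. The degree $d_i$ is the number of edges containing $i$. The Laplacian $L_{\mathcal{G}}$ has $(L_{\mathcal{G}})_{ii}=d_i$ and $(L_{\mathcal{G}})_{ij}=-\sum_{e\in E,\, i,j\in e}\frac{1}{|e|-1}$ for $i\ne j$; $\lambda_2(L_{\mathcal{G}})$ is its second smallest eigenvalue. A path of length $l$ between $v_0,v_l$ is an alternating sequence $v_0e_1v_1\dots e_lv_l$ of distinct vertices and distinct edges with $v_{i-1},v_i\in e_i$; $d(i,j)$ is the minimum length of an $i$–$j$ path and $\operatorname{diam}(\mathcal{G})=\max_{i,j}d(i,j)$; connected means all distances are finite. -}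

module Defs where

open import Algebra.Bundles.Raw using (RawMonoid)
import Algebra.Definitions.RawMonoid as RawMonoidDefs
open import Data.Fin as Fin using (Fin; inject₁; fromℕ; fromℕ<)
open import Data.Fin.Subset using (Subset; _∈_) renaming (∣_∣ to card)
open import Data.Fin.Subset.Properties using (_∈?_)
open import Data.Integer using (+_)
open import Data.List using (List; length; filter; map; foldr)
open import Data.List.Extrema.Nat using (max)
import Data.List.Membership.Propositional as List
open import Data.List.Relation.Unary.All using (All)
open import Data.List.Relation.Unary.Unique.Propositional using (Unique)
open import Data.Nat as ℕ using (ℕ; zero; suc)
import Data.Nat.Properties as ℕ
open import Data.Product using (Σ-syntax; ∃-syntax; _×_; _,_)
open import Data.Rational as ℚ using (ℚ; 0ℚ; 1ℚ; ½; ∣_∣)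
import Data.Rational.Properties as ℚ
open import Data.Rational.Solver using (module +-*-Solver)
open import Function.Definitions using (Injective)
open import Level using (0ℓ)
open import Relation.Binary.PropositionalEquality using (_≡_; refl; sym; trans; cong; cong₂; subst)
open import Relation.Nullary using (yes; no; contradiction; _×-dec_)

ℕ→ℚ : ℕ → ℚ
ℕ→ℚ n = + n ℚ./ 1

-- Total inverse, with value 0 at 0.
invℚ : ℚ → ℚ
invℚ p with p ℚ.≟ 0ℚ
... | yes _   = 0ℚ
... | no p≢0 = ℚ.1/_ p {{ℚ.≢-nonZero p≢0}}

private
  open +-*-Solver using (solve; _:=_; _:+_; _:*_; _:-_)

  *-mono-≤ : ∀ {p q r s} → 0ℚ ℚ.≤ r → 0ℚ ℚ.≤ q → p ℚ.≤ q → r ℚ.≤ s → p ℚ.* r ℚ.≤ q ℚ.* s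
  *-mono-≤ {p} {q} {r} {s} 0≤r 0≤q p≤q r≤s = ℚ.≤-trans
    (ℚ.*-monoʳ-≤-nonNeg r {{ℚ.nonNegative 0≤r}} p≤q)
    (ℚ.*-monoˡ-≤-nonNeg q {{ℚ.nonNegative 0≤q}} r≤s)

  *-pos : ∀ p q → 0ℚ ℚ.< p → 0ℚ ℚ.< q → 0ℚ ℚ.< p ℚ.* q
  *-pos p q 0<p 0<q =
    ℚ.positive⁻¹ _ {{ℚ.pos*pos⇒pos p {{ℚ.positive 0<p}} q {{ℚ.positive 0<q}}}}

  invℚ-inverse : ∀ p → 0ℚ ℚ.< ∣ p ∣ → invℚ p ℚ.* p ≡ 1ℚ
  invℚ-inverse p 0<∣p∣ with p ℚ.≟ 0ℚ
  ... | yes refl = contradiction 0<∣p∣ (ℚ.<-irrefl refl)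
  ... | no p≢0  = ℚ.*-inverseˡ p {{ℚ.≢-nonZero p≢0}}

  recip : ∀ p → 0ℚ ℚ.< p → Σ[ q ∈ ℚ ] 0ℚ ℚ.< q × q ℚ.* p ≡ 1ℚ
  recip p 0<p = 1/p , ℚ.positive⁻¹ _ {{ℚ.1/pos⇒pos p {{pos}}}} , ℚ.*-inverseˡ p {{nz}}
    where
    pos = ℚ.positive 0<p
    nz  = ℚ.pos⇒nonZero p {{pos}}
    1/p = ℚ.1/_ p {{nz}}

  ∣invℚ∣≤ : ∀ {δ q} p → 0ℚ ℚ.< δ → q ℚ.* δ ≡ 1ℚ → 0ℚ ℚ.< q → δ ℚ.≤ ∣ p ∣ → ∣ invℚ p ∣ ℚ.≤ q
  ∣invℚ∣≤ {δ} {q} p 0<δ qδ≡1 0<q δ≤p = ℚ.*-cancelʳ-≤-pos δ {{ℚ.positive 0<δ}} (begin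
    ∣ invℚ p ∣ ℚ.* δ       ≤⟨ ℚ.*-monoˡ-≤-nonNeg ∣ invℚ p ∣ {{ℚ.∣-∣-nonNeg (invℚ p)}} δ≤p ⟩
    ∣ invℚ p ∣ ℚ.* ∣ p ∣   ≡⟨ sym (ℚ.∣p*q∣≡∣p∣*∣q∣ (invℚ p) p) ⟩
    ∣ invℚ p ℚ.* p ∣       ≡⟨ cong ∣_∣ (invℚ-inverse p (ℚ.<-≤-trans 0<δ δ≤p)) ⟩
    1ℚ                     ≡⟨ sym qδ≡1 ⟩
    q ℚ.* δ                ∎)
    where open ℚ.≤-Reasoning

  sub-+ : ∀ a b c d → (a ℚ.+ b) ℚ.- (c ℚ.+ d) ≡ (a ℚ.- c) ℚ.+ (b ℚ.- d)
  sub-+ = solve 4 (λ a b c d → (a :+ b) :- (c :+ d) := (a :- c) :+ (b :- d)) refl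

  sub-add : ∀ a b → a ≡ (a ℚ.- b) ℚ.+ b
  sub-add = solve 2 (λ a b → a := (a :- b) :+ b) refl

  sub-* : ∀ a b c d → a ℚ.* b ℚ.- c ℚ.* d ≡ a ℚ.* (b ℚ.- d) ℚ.+ (a ℚ.- c) ℚ.* d
  sub-* = solve 4 (λ a b c d → a :* b :- c :* d := a :* (b :- d) :+ (a :- c) :* d) refl

  factor-ε : ∀ A B e r → A ℚ.* (e ℚ.* r) ℚ.+ (e ℚ.* r) ℚ.* B ≡ e ℚ.* (r ℚ.* (A ℚ.+ B))
  factor-ε = solve 4 (λ A B e r → A :* (e :* r) :+ (e :* r) :* B := e :* (r :* (A :+ B))) refl

  sub-inv : ∀ a b a' b' → a' ℚ.* (b' ℚ.* b) ℚ.- b' ℚ.* (a' ℚ.* a) ≡ (a' ℚ.* b') ℚ.* (b ℚ.- a)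
  sub-inv = solve 4 (λ a b a' b' → a' :* (b' :* b) :- b' :* (a' :* a) := (a' :* b') :* (b :- a)) refl

  regroup : ∀ r e d → (r ℚ.* r) ℚ.* (e ℚ.* (d ℚ.* d)) ≡ e ℚ.* ((r ℚ.* d) ℚ.* (r ℚ.* d))
  regroup = solve 3 (λ r e d → (r :* r) :* (e :* (d :* d)) := e :* ((r :* d) :* (r :* d))) refl

  halves : ∀ ε → ε ℚ.* ½ ℚ.+ ε ℚ.* ½ ≡ ε
  halves ε = trans (sym (ℚ.*-distribˡ-+ ε ½ ½)) (ℚ.*-identityʳ ε)

-- Real numbers: Cauchy sequences of rationals (each with a modulus of
-- convergence), considered up to _≈_.
Cauchy : (ℕ → ℚ) → Set
Cauchy x = ∀ ε → 0ℚ ℚ.< ε → ∃[ N ] (∀ m n → N ℕ.≤ m → N ℕ.≤ n → ∣ x m ℚ.- x n ∣ ℚ.≤ ε)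

record ℝ : Set where
  no-eta-equality
  constructor mkℝ
  field
    seq    : ℕ → ℚ
    cauchy : Cauchy seq

open ℝ public

infix  4 _≈_ _≤_ _#0
infixl 6 _+_ _-_
infixl 7 _*_

_≈_ : ℝ → ℝ → Set
x ≈ y = ∀ ε → 0ℚ ℚ.< ε → ∃[ N ] (∀ n → N ℕ.≤ n → ∣ seq x n ℚ.- seq y n ∣ ℚ.≤ ε)

_≤_ : ℝ → ℝ → Set
x ≤ y = ∀ ε → 0ℚ ℚ.< ε → ∃[ N ] (∀ n → N ℕ.≤ n → seq x n ℚ.≤ seq y n ℚ.+ ε)

-- Apartness from zero: the classical x ≢ 0 with a rational witness.
_#0 : ℝ → Set
x #0 = ∃[ δ ] 0ℚ ℚ.< δ × ∃[ N ] (∀ n → N ℕ.≤ n → δ ℚ.≤ ∣ seq x n ∣)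

ℚ→ℝ : ℚ → ℝ
ℚ→ℝ p = mkℝ (λ _ → p) prf
  where
  abstract
    prf : Cauchy (λ _ → p)
    prf ε 0<ε = 0 , λ _ _ _ _ →
      subst (ℚ._≤ ε) (sym (cong ∣_∣ (ℚ.+-inverseʳ p))) (ℚ.<⇒≤ 0<ε)

ℕ→ℝ : ℕ → ℝ
ℕ→ℝ n = ℚ→ℝ (ℕ→ℚ n)

0ℝ 1ℝ : ℝ
0ℝ = ℚ→ℝ 0ℚ
1ℝ = ℚ→ℝ 1ℚ

_+_ : ℝ → ℝ → ℝ
x + y = mkℝ (λ n → seq x n ℚ.+ seq y n) prf
  where
  abstract
    prf : Cauchy (λ n → seq x n ℚ.+ seq y n)
    prf ε 0<ε =
      let 0<ε/2 = *-pos ε ½ 0<ε (ℚ.positive⁻¹ ½)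
          M , p = cauchy x (ε ℚ.* ½) 0<ε/2
          N , q = cauchy y (ε ℚ.* ½) 0<ε/2
      in M ℕ.⊔ N , λ m n hm hn →
        let a = seq x m ; b = seq y m ; c = seq x n ; d = seq y n in begin
        ∣ (a ℚ.+ b) ℚ.- (c ℚ.+ d) ∣      ≡⟨ cong ∣_∣ (sub-+ a b c d) ⟩
        ∣ (a ℚ.- c) ℚ.+ (b ℚ.- d) ∣      ≤⟨ ℚ.∣p+q∣≤∣p∣+∣q∣ (a ℚ.- c) (b ℚ.- d) ⟩
        ∣ a ℚ.- c ∣ ℚ.+ ∣ b ℚ.- d ∣      ≤⟨ ℚ.+-mono-≤ (p m n (ℕ.m⊔n≤o⇒m≤o M N hm) (ℕ.m⊔n≤o⇒m≤o M N hn))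
                                                        (q m n (ℕ.m⊔n≤o⇒n≤o M N hm) (ℕ.m⊔n≤o⇒n≤o M N hn)) ⟩
        ε ℚ.* ½ ℚ.+ ε ℚ.* ½              ≡⟨ halves ε ⟩
        ε                                ∎
      where open ℚ.≤-Reasoning

-_ : ℝ → ℝ
- x = mkℝ (λ n → ℚ.- seq x n) prf
  where
  abstract
    prf : Cauchy (λ n → ℚ.- seq x n)
    prf ε 0<ε =
      let N , p = cauchy x ε 0<ε
      in N , λ m n hm hn → subst (ℚ._≤ ε)
           (trans (sym (ℚ.∣-p∣≡∣p∣ (seq x m ℚ.- seq x n)))
                  (cong ∣_∣ (ℚ.neg-distrib-+ (seq x m) (ℚ.- seq x n))))
           (p m n hm hn)

_-_ : ℝ → ℝ → ℝ
x - y = x + (- y)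

private
  bounded : ∀ x → Cauchy x → ∃[ B ] 0ℚ ℚ.< B × ∃[ N ] (∀ n → N ℕ.≤ n → ∣ x n ∣ ℚ.≤ B)
  bounded x c =
    let N , p = c 1ℚ (ℚ.positive⁻¹ 1ℚ)
    in 1ℚ ℚ.+ ∣ x N ∣
     , ℚ.+-mono-<-≤ (ℚ.positive⁻¹ 1ℚ) (ℚ.0≤∣p∣ (x N))
     , N
     , λ n hn → begin
       ∣ x n ∣                          ≡⟨ cong ∣_∣ (sub-add (x n) (x N)) ⟩
       ∣ (x n ℚ.- x N) ℚ.+ x N ∣        ≤⟨ ℚ.∣p+q∣≤∣p∣+∣q∣ (x n ℚ.- x N) (x N) ⟩
       ∣ x n ℚ.- x N ∣ ℚ.+ ∣ x N ∣      ≤⟨ ℚ.+-monoˡ-≤ ∣ x N ∣ (p n N hn ℕ.≤-refl) ⟩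
       1ℚ ℚ.+ ∣ x N ∣                   ∎
    where open ℚ.≤-Reasoning

private
  *-estimate : ∀ a b c d A B r ε → 0ℚ ℚ.< A → 0ℚ ℚ.< ε ℚ.* r → r ℚ.* (A ℚ.+ B) ≡ 1ℚ →
    ∣ a ∣ ℚ.≤ A → ∣ d ∣ ℚ.≤ B → ∣ a ℚ.- c ∣ ℚ.≤ ε ℚ.* r → ∣ b ℚ.- d ∣ ℚ.≤ ε ℚ.* r →
    ∣ a ℚ.* b ℚ.- c ℚ.* d ∣ ℚ.≤ ε
  *-estimate a b c d A B r ε 0<A 0<εr r[A+B]≡1 a≤A d≤B ac bd = begin
    ∣ a ℚ.* b ℚ.- c ℚ.* d ∣
      ≡⟨ cong ∣_∣ (sub-* a b c d) ⟩
    ∣ a ℚ.* (b ℚ.- d) ℚ.+ (a ℚ.- c) ℚ.* d ∣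
      ≤⟨ ℚ.∣p+q∣≤∣p∣+∣q∣ (a ℚ.* (b ℚ.- d)) ((a ℚ.- c) ℚ.* d) ⟩
    ∣ a ℚ.* (b ℚ.- d) ∣ ℚ.+ ∣ (a ℚ.- c) ℚ.* d ∣
      ≡⟨ cong₂ ℚ._+_ (ℚ.∣p*q∣≡∣p∣*∣q∣ a (b ℚ.- d)) (ℚ.∣p*q∣≡∣p∣*∣q∣ (a ℚ.- c) d) ⟩
    ∣ a ∣ ℚ.* ∣ b ℚ.- d ∣ ℚ.+ ∣ a ℚ.- c ∣ ℚ.* ∣ d ∣
      ≤⟨ ℚ.+-mono-≤ (*-mono-≤ (ℚ.0≤∣p∣ (b ℚ.- d)) (ℚ.<⇒≤ 0<A) a≤A bd)
                    (*-mono-≤ (ℚ.0≤∣p∣ d) (ℚ.<⇒≤ 0<εr) ac d≤B) ⟩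
    A ℚ.* (ε ℚ.* r) ℚ.+ (ε ℚ.* r) ℚ.* B
      ≡⟨ factor-ε A B ε r ⟩
    ε ℚ.* (r ℚ.* (A ℚ.+ B))
      ≡⟨ cong (ε ℚ.*_) r[A+B]≡1 ⟩
    ε ℚ.* 1ℚ
      ≡⟨ ℚ.*-identityʳ ε ⟩
    ε ∎
    where open ℚ.≤-Reasoning

  invℚ-estimate : ∀ a b δ r ε → 0ℚ ℚ.< δ → 0ℚ ℚ.< r → r ℚ.* δ ≡ 1ℚ →
    δ ℚ.≤ ∣ a ∣ → δ ℚ.≤ ∣ b ∣ → ∣ b ℚ.- a ∣ ℚ.≤ ε ℚ.* (δ ℚ.* δ) →
    ∣ invℚ a ℚ.- invℚ b ∣ ℚ.≤ ε
  invℚ-estimate a b δ r ε 0<δ 0<r rδ≡1 δ≤a δ≤b ba = go (invℚ a) (invℚ b)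
    (invℚ-inverse a (ℚ.<-≤-trans 0<δ δ≤a)) (invℚ-inverse b (ℚ.<-≤-trans 0<δ δ≤b))
    (∣invℚ∣≤ a 0<δ rδ≡1 0<r δ≤a) (∣invℚ∣≤ b 0<δ rδ≡1 0<r δ≤b)
    where
    open ℚ.≤-Reasoning
    go : ∀ a' b' → a' ℚ.* a ≡ 1ℚ → b' ℚ.* b ≡ 1ℚ → ∣ a' ∣ ℚ.≤ r → ∣ b' ∣ ℚ.≤ r → ∣ a' ℚ.- b' ∣ ℚ.≤ ε
    go a' b' a'a≡1 b'b≡1 a'≤r b'≤r = begin
      ∣ a' ℚ.- b' ∣
        ≡⟨ cong ∣_∣ (cong₂ ℚ._-_ (sym (ℚ.*-identityʳ a')) (sym (ℚ.*-identityʳ b'))) ⟩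
      ∣ a' ℚ.* 1ℚ ℚ.- b' ℚ.* 1ℚ ∣
        ≡⟨ cong ∣_∣ (cong₂ (λ s t → a' ℚ.* s ℚ.- b' ℚ.* t) (sym b'b≡1) (sym a'a≡1)) ⟩
      ∣ a' ℚ.* (b' ℚ.* b) ℚ.- b' ℚ.* (a' ℚ.* a) ∣
        ≡⟨ cong ∣_∣ (sub-inv a b a' b') ⟩
      ∣ (a' ℚ.* b') ℚ.* (b ℚ.- a) ∣
        ≡⟨ ℚ.∣p*q∣≡∣p∣*∣q∣ (a' ℚ.* b') (b ℚ.- a) ⟩
      ∣ a' ℚ.* b' ∣ ℚ.* ∣ b ℚ.- a ∣
        ≡⟨ cong (ℚ._* ∣ b ℚ.- a ∣) (ℚ.∣p*q∣≡∣p∣*∣q∣ a' b') ⟩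
      (∣ a' ∣ ℚ.* ∣ b' ∣) ℚ.* ∣ b ℚ.- a ∣
        ≤⟨ *-mono-≤ (ℚ.0≤∣p∣ (b ℚ.- a)) (ℚ.<⇒≤ (*-pos r r 0<r 0<r))
             (*-mono-≤ (ℚ.0≤∣p∣ b') (ℚ.<⇒≤ 0<r) a'≤r b'≤r) ba ⟩
      (r ℚ.* r) ℚ.* (ε ℚ.* (δ ℚ.* δ))
        ≡⟨ regroup r ε δ ⟩
      ε ℚ.* ((r ℚ.* δ) ℚ.* (r ℚ.* δ))
        ≡⟨ cong (ε ℚ.*_) (cong₂ ℚ._*_ rδ≡1 rδ≡1) ⟩
      ε ℚ.* 1ℚ
        ≡⟨ ℚ.*-identityʳ ε ⟩
      ε ∎

_*_ : ℝ → ℝ → ℝ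
x * y = mkℝ (λ n → seq x n ℚ.* seq y n) prf
  where
  abstract
    prf : Cauchy (λ n → seq x n ℚ.* seq y n)
    prf ε 0<ε =
      let A , 0<A , K , hA = bounded (seq x) (cauchy x)
          B , 0<B , L , hB = bounded (seq y) (cauchy y)
          r , 0<r , r[A+B]≡1 = recip (A ℚ.+ B) (ℚ.+-mono-< 0<A 0<B)
      in go A B r K L 0<A (*-pos ε r 0<ε 0<r) r[A+B]≡1 hA hB
      where
      go : ∀ A B r K L → 0ℚ ℚ.< A → 0ℚ ℚ.< ε ℚ.* r → r ℚ.* (A ℚ.+ B) ≡ 1ℚ →
        (∀ n → K ℕ.≤ n → ∣ seq x n ∣ ℚ.≤ A) → (∀ n → L ℕ.≤ n → ∣ seq y n ∣ ℚ.≤ B) →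
        ∃[ N ] (∀ m n → N ℕ.≤ m → N ℕ.≤ n → ∣ seq x m ℚ.* seq y m ℚ.- seq x n ℚ.* seq y n ∣ ℚ.≤ ε)
      go A B r K L 0<A 0<εr r[A+B]≡1 hA hB =
        let M , p = cauchy x (ε ℚ.* r) 0<εr
            N , q = cauchy y (ε ℚ.* r) 0<εr
            left : ∀ {k} → (K ℕ.⊔ L) ℕ.⊔ (M ℕ.⊔ N) ℕ.≤ k → K ℕ.⊔ L ℕ.≤ k
            left = ℕ.m⊔n≤o⇒m≤o (K ℕ.⊔ L) (M ℕ.⊔ N)
            right : ∀ {k} → (K ℕ.⊔ L) ℕ.⊔ (M ℕ.⊔ N) ℕ.≤ k → M ℕ.⊔ N ℕ.≤ k
            right = ℕ.m⊔n≤o⇒n≤o (K ℕ.⊔ L) (M ℕ.⊔ N)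
        in (K ℕ.⊔ L) ℕ.⊔ (M ℕ.⊔ N) , λ m n hm hn →
          *-estimate (seq x m) (seq y m) (seq x n) (seq y n) A B r ε 0<A 0<εr r[A+B]≡1
            (hA m (ℕ.m⊔n≤o⇒m≤o K L (left hm)))
            (hB n (ℕ.m⊔n≤o⇒n≤o K L (left hn)))
            (p m n (ℕ.m⊔n≤o⇒m≤o M N (right hm)) (ℕ.m⊔n≤o⇒m≤o M N (right hn)))
            (q m n (ℕ.m⊔n≤o⇒n≤o M N (right hm)) (ℕ.m⊔n≤o⇒n≤o M N (right hn)))

inv : (x : ℝ) → x #0 → ℝ
inv x (δ , 0<δ , K , δ≤) = mkℝ (λ n → invℚ (seq x n)) prf
  where
  abstract
    prf : Cauchy (λ n → invℚ (seq x n))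
    prf ε 0<ε with recip δ 0<δ | cauchy x (ε ℚ.* (δ ℚ.* δ)) (*-pos ε (δ ℚ.* δ) 0<ε (*-pos δ δ 0<δ 0<δ))
    ... | r , 0<r , rδ≡1 | N , p = K ℕ.⊔ N , λ m n hm hn →
      invℚ-estimate (seq x m) (seq x n) δ r ε 0<δ 0<r rδ≡1
        (δ≤ m (ℕ.m⊔n≤o⇒m≤o K N hm)) (δ≤ n (ℕ.m⊔n≤o⇒m≤o K N hn))
        (p n m (ℕ.m⊔n≤o⇒n≤o K N hn) (ℕ.m⊔n≤o⇒n≤o K N hm))

divide : (x y : ℝ) → y #0 → ℝ
divide x y y#0 = x * inv y y#0

+-rawMonoid : RawMonoid 0ℓ 0ℓ
+-rawMonoid = record { Carrier = ℝ ; _≈_ = _≈_ ; _∙_ = _+_ ; ε = 0ℝ }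

open RawMonoidDefs +-rawMonoid public using (sum)

Vector Matrix : ℕ → Set
Vector n = Fin n → ℝ
Matrix n = Fin n → Fin n → ℝ

IsEigenpair : ∀ {n} → Matrix n → ℝ → Vector n → Set
IsEigenpair M μ v = ∀ i → sum (λ j → M i j * v j) ≈ μ * v i

LinearlyIndependent : ∀ {n k} → (Fin k → Vector n) → Set
LinearlyIndependent {n} {k} v =
  (c : Fin k → ℝ) → (∀ i → sum (λ j → c j * v j i) ≈ 0ℝ) → ∀ j → c j ≈ 0ℝ

-- The n eigenvalues of M, listed in nondecreasing order and with
-- multiplicity. Since the n eigenvectors form a basis, each eigenvalue
-- occurs as often as the dimension of its eigenspace. A real symmetric
-- matrix has such a listing, and its eigenvalues do not depend on the choice
-- of basis.
record Spectrum {n} (M : Matrix n) : Set where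
  field
    eigenvalue  : Fin n → ℝ
    eigenvector : Fin n → Vector n
    eigenpair   : ∀ i → IsEigenpair M (eigenvalue i) (eigenvector i)
    independent : LinearlyIndependent eigenvector
    ordered     : ∀ i j → i Fin.≤ j → eigenvalue i ≤ eigenvalue j

secondSmallest : ∀ {n} {M : Matrix n} → 2 ℕ.≤ n → Spectrum M → ℝ
secondSmallest 2≤n σ = Spectrum.eigenvalue σ (fromℕ< 2≤n)

-- The edge set is a duplicate-free list; the vertex set is Fin n.
record Hypergraph (n : ℕ) : Set where
  field
    edges    : List (Subset n)
    distinct : Unique edges
    size≥2   : All (λ e → 2 ℕ.≤ card e) edges

module _ {n : ℕ} (G : Hypergraph n) where
  open Hypergraph G

  rank : ℕ
  rank = max 0 (map card edges)

  degree : Fin n → ℕ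
  degree i = length (filter (i ∈?_) edges)

  -- Edges have at least two vertices, so ∸ and invℚ take no default value.
  codegree : Fin n → Fin n → ℚ
  codegree i j = foldr ℚ._+_ 0ℚ
    (map (λ e → invℚ (ℕ→ℚ (card e ℕ.∸ 1))) (filter (λ e → (i ∈? e) ×-dec (j ∈? e)) edges))

  laplacian : Matrix n
  laplacian i j with i Fin.≟ j
  ... | yes _ = ℕ→ℝ (degree i)
  ... | no  _ = - ℚ→ℝ (codegree i j)

  record Path (u v : Fin n) (l : ℕ) : Set where
    field
      vertex      : Fin (suc l) → Fin n
      edge        : Fin l → Subset n
      edge∈       : ∀ k → edge k List.∈ edges
      vertex-inj  : Injective _≡_ _≡_ vertex
      edge-inj    : Injective _≡_ _≡_ edge
      source      : vertex Fin.zero ≡ u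
      target      : vertex (fromℕ l) ≡ v
      incident    : ∀ k → vertex (inject₁ k) ∈ edge k × vertex (Fin.suc k) ∈ edge k

  Connected : Set
  Connected = ∀ u v → ∃[ l ] Path u v l

  IsDistance : Fin n → Fin n → ℕ → Set
  IsDistance u v d = Path u v d × (∀ l → Path u v l → d ℕ.≤ l)

  IsDiameter : ℕ → Set
  IsDiameter D = (∃[ u ] ∃[ v ] IsDistance u v D) × (∀ u v d → IsDistance u v d → d ℕ.≤ D)

{-# OPTIONS --safe #-}
-- Let f be orthogonal to the constants, ρ = r - 1 and D the diameter. Fix a geodesic
-- between any two vertices. Cauchy–Schwarz along the geodesics bounds Σ_{u,v} (f u - f v)² by
-- D Σ_{a,b} c(a,b) (f a - f b)², where c(a,b) counts the geodesics stepping from a to b. Such a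
-- geodesic starts closer to a than to b and ends closer to b than to a, so c(a,b) ≤ |A| |B| ≤ n²/4
-- for disjoint vertex sets A and B (Mohar's argument). Adjacent pairs have Laplacian weight at
-- least 1/ρ, which gives the Poincaré inequality 4 ‖f‖² ≤ D n ρ ⟨f, L f⟩.
--
-- The matrix L is rational, so this is an inequality over ℚ that holds at every index of the
-- Cauchy sequences representing a real vector. As ≤ on ℝ is the negation of a strict inequality,
-- it suffices to refute D n ρ λ₂ < 4. Then no eigenvector of λ₁ or λ₂ is orthogonal to the
-- constants; but L has zero column sums, so λ₁ = λ₂ = 0, and a combination of the two eigenvectors
-- that is orthogonal to the constants must vanish, contradicting independence.
module Submission where

open import Data.Fin as Fin using (Fin)

-- Walks, distances and geodesics.

module Walks where
  open import Data.Fin using (zero; suc; toℕ; fromℕ; inject₁)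
  open import Data.Fin.Properties using (toℕ-inject₁; toℕ-injective) renaming (any? to anyFin?)
  open import Data.Fin.Subset using (Subset; _∈_)
  open import Data.Fin.Subset.Properties using (_∈?_)
  open import Data.List.Membership.Propositional using (find; lose) renaming (_∈_ to _∈ˡ_)
  open import Data.List.Relation.Unary.Any as Any using (Any)
  open import Data.Nat using (ℕ; zero; suc; _+_; _≤_; _<_; s≤s; z≤n)
  open import Data.Nat.Properties
  open import Data.Product using (∃-syntax; _×_; _,_; proj₁; proj₂; swap)
  open import Defs using (Hypergraph; Path; Connected; IsDistance; IsDiameter)
  open import Function using (_∘_)
  open import Relation.Binary using (tri<; tri≈; tri>)
  open import Relation.Binary.PropositionalEquality
  open import Relation.Nullary using (Dec; yes; no; contradiction; _×-dec_)
  open import Relation.Nullary.Decidable using (map′)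
  open import Relation.Unary using (Decidable)

  least : ∀ {P : ℕ → Set} → Decidable P → ∀ l → P l → ∃[ d ] P d × (∀ k → P k → d ≤ k)
  least P? zero    p = 0 , p , λ _ _ → z≤n
  least P? (suc l) p with P? 0
  ... | yes p₀ = 0 , p₀ , λ _ _ → z≤n
  ... | no ¬p₀ =
    let d , q , minimal = least (P? ∘ suc) l p
    in suc d , q , λ { zero r → contradiction r ¬p₀ ; (suc k) r → s≤s (minimal k r) }

  module _ {n : ℕ} (G : Hypergraph n) where
    open Hypergraph G

    Adjacent : Fin n → Fin n → Set
    Adjacent u v = Any (λ e → u ∈ e × v ∈ e) edges

    adjacent? : ∀ u v → Dec (Adjacent u v)
    adjacent? u v = Any.any? (λ e → (u ∈? e) ×-dec (v ∈? e)) edges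

    adjacent-sym : ∀ {u v} → Adjacent u v → Adjacent v u
    adjacent-sym = Any.map swap

    infixr 5 _∷_

    -- Repetitions are allowed, so walks can be concatenated, reversed and decided by recursion on
    -- the length. Distinctness of vertices and edges is recovered for shortest walks only.
    data Walk : Fin n → Fin n → ℕ → Set where
      []  : ∀ {v} → Walk v v 0
      _∷_ : ∀ {u w v l} → Adjacent u w → Walk w v l → Walk u v (suc l)

    walk? : ∀ u v l → Dec (Walk u v l)
    walk? u v zero    = map′ (λ { refl → [] }) (λ { [] → refl }) (u Fin.≟ v)
    walk? u v (suc l) = map′ (λ (_ , a , p) → a ∷ p) (λ { (a ∷ p) → _ , a , p })
      (anyFin? λ w → adjacent? u w ×-dec walk? w v l)

    _++_ : ∀ {u v w k l} → Walk u v k → Walk v w l → Walk u w (k + l)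
    []      ++ q = q
    (a ∷ p) ++ q = a ∷ (p ++ q)

    reverse : ∀ {u v l} → Walk u v l → Walk v u l
    reverse []      = []
    reverse (_∷_ {l = l} a p) = subst (Walk _ _) (+-comm l 1) (reverse p ++ (adjacent-sym a ∷ []))

    vertices : ∀ {u v l} → Walk u v l → Fin (suc l) → Fin n
    vertices {u} p       zero    = u
    vertices     (a ∷ p) (suc k) = vertices p k

    vertices-last : ∀ {u v l} (p : Walk u v l) → vertices p (fromℕ l) ≡ v
    vertices-last []      = refl
    vertices-last (a ∷ p) = vertices-last p

    walkEdges : ∀ {u v l} → Walk u v l → Fin l → Subset n
    walkEdges (a ∷ p) zero    = proj₁ (find a)
    walkEdges (a ∷ p) (suc k) = walkEdges p k

    walkEdges∈ : ∀ {u v l} (p : Walk u v l) k → walkEdges p k ∈ˡ edges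
    walkEdges∈ (a ∷ p) zero    = proj₁ (proj₂ (find a))
    walkEdges∈ (a ∷ p) (suc k) = walkEdges∈ p k

    walk-incident : ∀ {u v l} (p : Walk u v l) k →
      vertices p (inject₁ k) ∈ walkEdges p k × vertices p (suc k) ∈ walkEdges p k
    walk-incident (a ∷ [])    zero    = proj₂ (proj₂ (find a))
    walk-incident (a ∷ _ ∷ _) zero    = proj₂ (proj₂ (find a))
    walk-incident (a ∷ p)     (suc k) = walk-incident p k

    sequence⇒walk : ∀ l (x : Fin (suc l) → Fin n) →
      (∀ k → Adjacent (x (inject₁ k)) (x (suc k))) → Walk (x zero) (x (fromℕ l)) l
    sequence⇒walk zero    x step = []
    sequence⇒walk (suc l) x step = step zero ∷ sequence⇒walk l (x ∘ suc) (step ∘ suc)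

    path⇒walk : ∀ {u v l} → Path G u v l → Walk u v l
    path⇒walk {l = l} P = subst₂ (λ u v → Walk u v l) source target
      (sequence⇒walk l vertex λ k → lose (edge∈ k) (incident k))
      where open Path P

    module Distance (connected : Connected G) where

      -- Existence of a walk of given length is decidable, so the least length is found by a search
      -- bounded by the length of the path that connectedness supplies.
      shortest : ∀ u v → ∃[ d ] Walk u v d × (∀ k → Walk u v k → d ≤ k)
      shortest u v = let l , P = connected u v in least (walk? u v) l (path⇒walk P)

      dist : Fin n → Fin n → ℕ
      dist u v = proj₁ (shortest u v)

      geodesic : ∀ u v → Walk u v (dist u v)
      geodesic u v = proj₁ (proj₂ (shortest u v))

      dist-minimal : ∀ {u v l} → Walk u v l → dist u v ≤ l
      dist-minimal p = proj₂ (proj₂ (shortest _ _)) _ p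

      dist-self : ∀ v → dist v v ≡ 0
      dist-self v = n≤0⇒n≡0 (dist-minimal [])

      dist-sym : ∀ u v → dist u v ≡ dist v u
      dist-sym u v = ≤-antisym (dist-minimal (reverse (geodesic v u))) (dist-minimal (reverse (geodesic u v)))

      dist-triangle : ∀ u v w → dist u w ≤ dist u v + dist v w
      dist-triangle u v w = dist-minimal (geodesic u v ++ geodesic v w)

      dist-adjacent : ∀ {u w} v → Adjacent u w → dist u v ≤ suc (dist w v)
      dist-adjacent v a = dist-minimal (a ∷ geodesic _ v)

      dist-tail : ∀ {u w v l} → Adjacent u w → Walk w v l → dist u v ≡ suc l → dist w v ≡ l
      dist-tail {v = v} a p d≡1+l =
        ≤-antisym (dist-minimal p) (≤-pred (subst (_≤ _) d≡1+l (dist-adjacent v a)))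

      -- Each tail of a geodesic is again a geodesic, so every step lowers the distance to the
      -- target by exactly one. The additive form avoids truncated subtraction.
      dist-vertices : ∀ {u v l} (p : Walk u v l) → dist u v ≡ l → ∀ k → dist (vertices p k) v + toℕ k ≡ l
      dist-vertices p       d≡l zero    = trans (+-identityʳ _) d≡l
      dist-vertices (a ∷ p) d≡l (suc k) =
        trans (+-suc _ (toℕ k)) (cong suc (dist-vertices p (dist-tail a p d≡l) k))

      -- The distance to the target determines the position on a geodesic.
      vertices-injective : ∀ {u v l} (p : Walk u v l) → dist u v ≡ l →
        ∀ {j k} → vertices p j ≡ vertices p k → j ≡ k
      vertices-injective {v = v} p d≡l {j} {k} eq = toℕ-injective (+-cancelˡ-≡ (dist (vertices p j) v) _ _ (begin
        dist (vertices p j) v + toℕ j  ≡⟨ dist-vertices p d≡l j ⟩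
        _                              ≡⟨ dist-vertices p d≡l k ⟨
        dist (vertices p k) v + toℕ k  ≡⟨ cong (λ x → dist x v + toℕ k) eq ⟨
        dist (vertices p j) v + toℕ k  ∎))
        where open ≡-Reasoning

      -- An edge used at steps j < k would join x_j to x_{k+1} directly.
      walkEdges-distinct : ∀ {u v l} (p : Walk u v l) → dist u v ≡ l →
        ∀ {j k} → toℕ j < toℕ k → walkEdges p j ≢ walkEdges p k
      walkEdges-distinct {v = v} {l} p d≡l {j} {k} j<k eq = <-irrefl refl (begin-strict
        l                                               ≡⟨ dist-vertices p d≡l (inject₁ j) ⟨
        dist (vertices p (inject₁ j)) v + toℕ (inject₁ j)
          ≡⟨ cong (dist (vertices p (inject₁ j)) v +_) (toℕ-inject₁ j) ⟩
        dist (vertices p (inject₁ j)) v + toℕ j         <⟨ +-monoʳ-< (dist (vertices p (inject₁ j)) v) j<k ⟩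
        dist (vertices p (inject₁ j)) v + toℕ k         ≤⟨ +-monoˡ-≤ (toℕ k) (dist-adjacent v shortcut) ⟩
        suc (dist (vertices p (suc k)) v + toℕ k)       ≡⟨ +-suc _ (toℕ k) ⟨
        dist (vertices p (suc k)) v + suc (toℕ k)       ≡⟨ dist-vertices p d≡l (suc k) ⟩
        l                                               ∎)
        where
        open ≤-Reasoning
        shortcut : Adjacent (vertices p (inject₁ j)) (vertices p (suc k))
        shortcut = lose (walkEdges∈ p j)
          (proj₁ (walk-incident p j) , subst (vertices p (suc k) ∈_) (sym eq) (proj₂ (walk-incident p k)))

      walkEdges-injective : ∀ {u v l} (p : Walk u v l) → dist u v ≡ l →
        ∀ {j k} → walkEdges p j ≡ walkEdges p k → j ≡ k
      walkEdges-injective p d≡l {j} {k} eq with <-cmp (toℕ j) (toℕ k)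
      ... | tri< j<k _ _ = contradiction eq (walkEdges-distinct p d≡l j<k)
      ... | tri≈ _ j≡k _ = toℕ-injective j≡k
      ... | tri> _ _ k<j = contradiction (sym eq) (walkEdges-distinct p d≡l k<j)

      -- The bridge from walks to paths: a geodesic repeats neither vertices nor edges, hence is a
      -- path, and every path yields a walk of the same length.
      dist-isDistance : ∀ u v → IsDistance G u v (dist u v)
      dist-isDistance u v = record
        { vertex     = vertices p
        ; edge       = walkEdges p
        ; edge∈      = walkEdges∈ p
        ; vertex-inj = vertices-injective p refl
        ; edge-inj   = walkEdges-injective p refl
        ; source     = refl
        ; target     = vertices-last p
        ; incident   = walk-incident p
        } , λ l P → dist-minimal (path⇒walk P)
        where p = geodesic u v

      dist≤diameter : ∀ {D} → IsDiameter G D → ∀ u v → dist u v ≤ D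
      dist≤diameter (_ , bound) u v = bound u v _ (dist-isDistance u v)

-- Rational arithmetic, finite sums and quadratic identities.

module Rationals where
  open import Algebra.Bundles using (CommutativeRing)
  open import Data.Bool using (if_then_else_)
  open import Data.Fin using (zero; suc)
  open import Data.Integer as ℤ using (+_)
  import Data.Integer.Properties as ℤ
  open import Data.Nat as ℕ using (ℕ; zero; suc)
  import Data.Nat.Coprimality as Coprimality
  import Data.Nat.Properties as ℕ
  open import Data.Rational
  open import Data.Rational.Properties
  open import Data.Rational.Solver using (module +-*-Solver)
  open import Data.Sum using (inj₁; inj₂)
  open import Defs using (ℕ→ℚ; invℚ)
  open import Relation.Binary.PropositionalEquality
  open import Relation.Nullary using (Dec; yes; no; does; contradiction)
  open +-*-Solver
  open import Algebra.Properties.Semiring.Sum (CommutativeRing.semiring +-*-commutativeRing) public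
    using (sum-cong-≗; ∑-distrib-+; ∑-comm; *-distribˡ-sum; *-distribʳ-sum)
    renaming (sum to ∑)

  2ℚ 4ℚ : ℚ
  2ℚ = ℕ→ℚ 2
  4ℚ = ℕ→ℚ 4

  ℕ→ℚ-suc : ∀ n → ℕ→ℚ (suc n) ≡ 1ℚ + ℕ→ℚ n
  ℕ→ℚ-suc n = begin
    + suc n / 1                         ≡⟨ cong (_/ 1) (cong (λ k → + suc k) (sym (ℕ.*-identityʳ n))) ⟩
    + suc (n ℕ.* 1) / 1                 ≡⟨ cong (λ z → (+ 1 ℤ.+ z) / 1) (ℤ.pos-* n 1) ⟩
    -- Addition of rationals unfolds on explicit fractions, so the reduced fraction stands in for
    -- `ℕ→ℚ n`, whose normalisation does not compute for a variable `n`.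
    1ℚ + mkℚ (+ n) 0 coprime            ≡⟨ cong (λ q → 1ℚ + q) (sym (normalize-coprime coprime)) ⟩
    1ℚ + ℕ→ℚ n                          ∎
    where
    open ≡-Reasoning
    coprime = Coprimality.sym (Coprimality.1-coprimeTo n)

  ℕ→ℚ-nonNeg : ∀ n → 0ℚ ≤ ℕ→ℚ n
  ℕ→ℚ-nonNeg n = nonNegative⁻¹ _ {{normalize-nonNeg n 1}}

  ℕ→ℚ-pos : ∀ n → 0ℚ < ℕ→ℚ (suc n)
  ℕ→ℚ-pos n = positive⁻¹ _ {{normalize-pos (suc n) 1}}

  ℕ→ℚ-mono : ∀ {m n} → m ℕ.≤ n → ℕ→ℚ m ≤ ℕ→ℚ n
  ℕ→ℚ-mono {n = n} ℕ.z≤n = ℕ→ℚ-nonNeg n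
  ℕ→ℚ-mono {suc m} {suc n} (ℕ.s≤s m≤n) =
    subst₂ _≤_ (sym (ℕ→ℚ-suc m)) (sym (ℕ→ℚ-suc n)) (+-monoʳ-≤ 1ℚ (ℕ→ℚ-mono m≤n))

  -- Reduces an inequality to a ring identity with a nonnegative remainder, often a square, so that
  -- the ring solver can do the rest.
  ≤-by : ∀ {p q} r → 0ℚ ≤ r → q ≡ p + r → p ≤ q
  ≤-by {p} {q} r 0≤r q≡p+r = subst₂ _≤_ (+-identityʳ p) (sym q≡p+r) (+-monoʳ-≤ p 0≤r)

  *-nonNeg : ∀ {p q} → 0ℚ ≤ p → 0ℚ ≤ q → 0ℚ ≤ p * q
  *-nonNeg {p} {q} 0≤p 0≤q =
    nonNegative⁻¹ _ {{nonNeg*nonNeg⇒nonNeg p {{nonNegative 0≤p}} q {{nonNegative 0≤q}}}}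

  *-pos : ∀ {p q} → 0ℚ < p → 0ℚ < q → 0ℚ < p * q
  *-pos {p} {q} 0<p 0<q = positive⁻¹ _ {{pos*pos⇒pos p {{positive 0<p}} q {{positive 0<q}}}}

  *-monoˡ-≤ : ∀ {p q} r → 0ℚ ≤ r → p ≤ q → r * p ≤ r * q
  *-monoˡ-≤ r 0≤r = *-monoˡ-≤-nonNeg r {{nonNegative 0≤r}}

  *-monoʳ-≤ : ∀ {p q} r → 0ℚ ≤ r → p ≤ q → p * r ≤ q * r
  *-monoʳ-≤ r 0≤r = *-monoʳ-≤-nonNeg r {{nonNegative 0≤r}}

  *-mono-≤ : ∀ {p q r s} → 0ℚ ≤ r → 0ℚ ≤ q → p ≤ q → r ≤ s → p * r ≤ q * s
  *-mono-≤ {q = q} {r} 0≤r 0≤q p≤q r≤s = ≤-trans (*-monoʳ-≤ r 0≤r p≤q) (*-monoˡ-≤ q 0≤q r≤s)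

  ∣p∣²≡p² : ∀ p → ∣ p ∣ * ∣ p ∣ ≡ p * p
  ∣p∣²≡p² p with ∣p∣≡p∨∣p∣≡-p p
  ... | inj₁ eq = cong₂ _*_ eq eq
  ... | inj₂ eq = trans (cong₂ _*_ eq eq) (solve 1 (λ p → (:- p) :* (:- p) := p :* p) refl p)

  square-nonNeg : ∀ p → 0ℚ ≤ p * p
  square-nonNeg p = subst (0ℚ ≤_) (∣p∣²≡p² p) (*-nonNeg (0≤∣p∣ p) (0≤∣p∣ p))

  invℚ-inverse : ∀ {p} → 0ℚ < p → invℚ p * p ≡ 1ℚ
  invℚ-inverse {p} 0<p with p ≟ 0ℚ
  ... | yes refl = contradiction 0<p (<-irrefl refl)
  ... | no p≢0  = *-inverseˡ p {{≢-nonZero p≢0}}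

  invℚ-pos : ∀ {p} → 0ℚ < p → 0ℚ < invℚ p
  invℚ-pos {p} 0<p with p ≟ 0ℚ
  ... | yes refl = contradiction 0<p (<-irrefl refl)
  ... | no p≢0  = positive⁻¹ _ {{1/pos⇒pos p {{positive 0<p}}}}

  ∑-mono : ∀ {n} {f g : Fin n → ℚ} → (∀ i → f i ≤ g i) → ∑ f ≤ ∑ g
  ∑-mono {zero}  f≤g = ≤-refl
  ∑-mono {suc n} f≤g = +-mono-≤ (f≤g zero) (∑-mono (λ i → f≤g (suc i)))

  ∑-zero : ∀ {n} {f : Fin n → ℚ} → (∀ i → f i ≡ 0ℚ) → ∑ f ≡ 0ℚ
  ∑-zero {zero}  f≡0 = refl
  ∑-zero {suc n} f≡0 = cong₂ _+_ (f≡0 zero) (∑-zero (λ i → f≡0 (suc i)))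

  ∑-nonNeg : ∀ {n} {f : Fin n → ℚ} → (∀ i → 0ℚ ≤ f i) → 0ℚ ≤ ∑ f
  ∑-nonNeg {n} {f} 0≤f = subst (_≤ ∑ f) (∑-zero {n} (λ _ → refl)) (∑-mono 0≤f)

  ∑-const : ∀ n c → ∑ {n} (λ _ → c) ≡ ℕ→ℚ n * c
  ∑-const zero    c = sym (*-zeroˡ c)
  ∑-const (suc n) c = begin
    c + ∑ {n} (λ _ → c)   ≡⟨ cong (λ s → c + s) (∑-const n c) ⟩
    c + ℕ→ℚ n * c         ≡⟨ solve 2 (λ c n → c :+ n :* c := (con 1ℚ :+ n) :* c) refl c (ℕ→ℚ n) ⟩
    (1ℚ + ℕ→ℚ n) * c      ≡⟨ cong (_* c) (ℕ→ℚ-suc n) ⟨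
    ℕ→ℚ (suc n) * c       ∎
    where open ≡-Reasoning

  term≤∑ : ∀ {n} {f : Fin n → ℚ} → (∀ i → 0ℚ ≤ f i) → ∀ i → f i ≤ ∑ f
  term≤∑ {f = f} 0≤f zero    = ≤-by _ (∑-nonNeg (λ i → 0≤f (suc i))) refl
  term≤∑ {f = f} 0≤f (suc i) =
    ≤-trans (term≤∑ (λ j → 0≤f (suc j)) i) (≤-by (f zero) (0≤f zero) (+-comm (f zero) _))

  -- Only `does` is inspected, so the indicator at `suc i` and `suc j` reduces to the one at `i` and
  -- `j`. The recursion in `∑-δ` relies on this.
  𝟙 : ∀ {P : Set} → Dec P → ℚ
  𝟙 P? = if does P? then 1ℚ else 0ℚ

  𝟙-nonNeg : ∀ {P : Set} (P? : Dec P) → 0ℚ ≤ 𝟙 P?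
  𝟙-nonNeg (yes _) = <⇒≤ (positive⁻¹ 1ℚ)
  𝟙-nonNeg (no _)  = ≤-refl

  𝟙-true : ∀ {P : Set} (P? : Dec P) → P → 𝟙 P? ≡ 1ℚ
  𝟙-true (yes _) p = refl
  𝟙-true (no ¬p) p = contradiction p ¬p

  ∑-δ : ∀ {n} (i : Fin n) (f : Fin n → ℚ) → ∑ (λ j → 𝟙 (i Fin.≟ j) * f j) ≡ f i
  ∑-δ zero    f = trans (cong₂ _+_ (*-identityˡ (f zero)) (∑-zero λ j → *-zeroˡ (f (suc j)))) (+-identityʳ (f zero))
  ∑-δ (suc i) f = trans (cong₂ _+_ (*-zeroˡ (f zero)) (∑-δ i (λ j → f (suc j)))) (+-identityˡ (f (suc i)))

  ∑∑-distribˡ : ∀ {m n} c (f : Fin m → Fin n → ℚ) → c * ∑ (λ i → ∑ (f i)) ≡ ∑ (λ i → ∑ (λ j → c * f i j))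
  ∑∑-distribˡ c f = trans (*-distribˡ-sum c (λ i → ∑ (f i))) (sum-cong-≗ λ i → *-distribˡ-sum c (f i))

  ∑∑-distribʳ : ∀ {m n} c (f : Fin m → Fin n → ℚ) → ∑ (λ i → ∑ (f i)) * c ≡ ∑ (λ i → ∑ (λ j → f i j * c))
  ∑∑-distribʳ c f = trans (*-distribʳ-sum c (λ i → ∑ (f i))) (sum-cong-≗ λ i → *-distribʳ-sum c (f i))

  ∑∑∑∑-swap : ∀ {n} (F : Fin n → Fin n → Fin n → Fin n → ℚ) →
    ∑ (λ u → ∑ (λ v → ∑ (λ a → ∑ (λ b → F u v a b)))) ≡ ∑ (λ a → ∑ (λ b → ∑ (λ u → ∑ (λ v → F u v a b))))
  ∑∑∑∑-swap F = begin
    ∑ (λ u → ∑ (λ v → ∑ (λ a → ∑ (λ b → F u v a b))))  ≡⟨ sum-cong-≗ (λ u → ∑-comm (λ v a → ∑ (λ b → F u v a b))) ⟩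
    ∑ (λ u → ∑ (λ a → ∑ (λ v → ∑ (λ b → F u v a b))))  ≡⟨ ∑-comm (λ u a → ∑ (λ v → ∑ (λ b → F u v a b))) ⟩
    ∑ (λ a → ∑ (λ u → ∑ (λ v → ∑ (λ b → F u v a b))))
      ≡⟨ sum-cong-≗ (λ a → sum-cong-≗ λ u → ∑-comm (λ v b → F u v a b)) ⟩
    ∑ (λ a → ∑ (λ u → ∑ (λ b → ∑ (λ v → F u v a b))))  ≡⟨ sum-cong-≗ (λ a → ∑-comm (λ u b → ∑ (λ v → F u v a b))) ⟩
    ∑ (λ a → ∑ (λ b → ∑ (λ u → ∑ (λ v → F u v a b))))  ∎
    where open ≡-Reasoning

  ∑∑-distrib-+ : ∀ {m n} (f g : Fin m → Fin n → ℚ) →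
    ∑ (λ i → ∑ (λ j → f i j + g i j)) ≡ ∑ (λ i → ∑ (f i)) + ∑ (λ i → ∑ (g i))
  ∑∑-distrib-+ f g = trans (sum-cong-≗ λ i → ∑-distrib-+ (f i) (g i)) (∑-distrib-+ (λ i → ∑ (f i)) (λ i → ∑ (g i)))

  ∑∑-cong : ∀ {m n} {f g : Fin m → Fin n → ℚ} → (∀ i j → f i j ≡ g i j) → ∑ (λ i → ∑ (f i)) ≡ ∑ (λ i → ∑ (g i))
  ∑∑-cong f≡g = sum-cong-≗ λ i → sum-cong-≗ (f≡g i)

  ∑∑-mono : ∀ {m n} {f g : Fin m → Fin n → ℚ} → (∀ i j → f i j ≤ g i j) → ∑ (λ i → ∑ (f i)) ≤ ∑ (λ i → ∑ (g i))
  ∑∑-mono f≤g = ∑-mono λ i → ∑-mono (f≤g i)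

  ∑-* : ∀ {m n} (f : Fin m → ℚ) (g : Fin n → ℚ) → ∑ (λ i → ∑ (λ j → f i * g j)) ≡ ∑ f * ∑ g
  ∑-* f g = trans (sum-cong-≗ λ i → sym (*-distribˡ-sum (f i) g)) (sym (*-distribʳ-sum (∑ g) f))

  -- Expanding the square leaves two copies of `n` times the sum of squares and a cross term that
  -- factors. The right side is a variance: it becomes `2 n ‖f‖²` when `f` is orthogonal to the
  -- constants.
  ∑∑-square-differences : ∀ {n} (f : Fin n → ℚ) →
    ∑ (λ u → ∑ (λ v → (f u - f v) * (f u - f v))) ≡ 2ℚ * (ℕ→ℚ n * ∑ (λ u → f u * f u) - ∑ f * ∑ f)
  ∑∑-square-differences {n} f = begin
    ∑ (λ u → ∑ (λ v → (f u - f v) * (f u - f v)))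
      -- The factors 1 bring each summand into the product form that `∑-*` factors.
      ≡⟨ ∑∑-cong (λ u v → solve 2 (λ x y → (x :- y) :* (x :- y) :=
           (x :* x :* con 1ℚ :+ con 1ℚ :* (y :* y)) :+ con (- 2ℚ) :* (x :* y)) refl (f u) (f v)) ⟩
    ∑ (λ u → ∑ (λ v → (A u v + B u v) + - 2ℚ * C u v))
      ≡⟨ ∑∑-distrib-+ (λ u v → A u v + B u v) (λ u v → - 2ℚ * C u v) ⟩
    ∑ (λ u → ∑ (λ v → A u v + B u v)) + ∑ (λ u → ∑ (λ v → - 2ℚ * C u v))
      ≡⟨ cong₂ _+_ (∑∑-distrib-+ A B) (sym (∑∑-distribˡ (- 2ℚ) C)) ⟩
    ∑ (λ u → ∑ (A u)) + ∑ (λ u → ∑ (B u)) + - 2ℚ * ∑ (λ u → ∑ (C u))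
      ≡⟨ cong₂ _+_ (cong₂ _+_ (∑-* {n} {n} (λ u → f u * f u) (λ _ → 1ℚ)) (∑-* {n} {n} (λ _ → 1ℚ) (λ v → f v * f v)))
                   (cong (- 2ℚ *_) (∑-* f f)) ⟩
    Q * ∑ {n} (λ _ → 1ℚ) + ∑ {n} (λ _ → 1ℚ) * Q + - 2ℚ * (s * s)
      ≡⟨ cong (λ c → Q * c + c * Q + - 2ℚ * (s * s)) (∑-const n 1ℚ) ⟩
    Q * (N * 1ℚ) + N * 1ℚ * Q + - 2ℚ * (s * s)
      ≡⟨ solve 3 (λ q n s → q :* (n :* con 1ℚ) :+ n :* con 1ℚ :* q :+ con (- 2ℚ) :* (s :* s) :=
           con 2ℚ :* (n :* q :- s :* s)) refl Q N s ⟩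
    2ℚ * (N * Q - s * s) ∎
    where
    open ≡-Reasoning

    N = ℕ→ℚ n
    Q = ∑ (λ u → f u * f u)
    s = ∑ f
    A B C : Fin n → Fin n → ℚ
    A u v = f u * f u * 1ℚ
    B u v = 1ℚ * (f v * f v)
    C u v = f u * f v

  -- The Dirichlet form of a weighted graph. Write (x - y)² = x (x - y) + y (y - x); by symmetry of
  -- the weights, exchanging the summation indices identifies the two halves.
  ∑∑-weighted-square-differences : ∀ {n} (c : Fin n → Fin n → ℚ) → (∀ i j → c i j ≡ c j i) → (f : Fin n → ℚ) →
    ∑ (λ i → ∑ (λ j → c i j * ((f i - f j) * (f i - f j)))) ≡ 2ℚ * ∑ (λ i → f i * ∑ (λ j → c i j * (f i - f j)))
  ∑∑-weighted-square-differences c c-sym f = begin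
    ∑ (λ i → ∑ (λ j → c i j * ((f i - f j) * (f i - f j))))
      ≡⟨ ∑∑-cong (λ i j → trans
           (solve 3 (λ c x y → c :* ((x :- y) :* (x :- y)) := x :* (c :* (x :- y)) :+ y :* (c :* (y :- x))) refl (c i j) (f i) (f j))
           (cong (λ z → e i j + f j * (z * (f j - f i))) (c-sym i j))) ⟩
    ∑ (λ i → ∑ (λ j → e i j + e j i))
      ≡⟨ ∑∑-distrib-+ e (λ i j → e j i) ⟩
    ∑ (λ i → ∑ (e i)) + ∑ (λ i → ∑ (λ j → e j i))
      ≡⟨ cong (λ z → ∑ (λ i → ∑ (e i)) + z) (∑-comm (λ i j → e j i)) ⟩
    ∑ (λ i → ∑ (e i)) + ∑ (λ i → ∑ (e i))
      ≡⟨ solve 1 (λ x → x :+ x := con 2ℚ :* x) refl (∑ (λ i → ∑ (e i))) ⟩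
    2ℚ * ∑ (λ i → ∑ (e i))
      ≡⟨ cong (2ℚ *_) (sum-cong-≗ λ i → *-distribˡ-sum (f i) (λ j → c i j * (f i - f j))) ⟨
    2ℚ * ∑ (λ i → f i * ∑ (λ j → c i j * (f i - f j))) ∎
    where
    open ≡-Reasoning
    e = λ i j → f i * (c i j * (f i - f j))

  -- For indicators of disjoint sets `A` and `B` this is 4 |A| |B| ≤ (|A| + |B|)² ≤ n².
  4∑∑-disjoint≤n² : ∀ {n} (χ ψ : Fin n → ℚ) → (∀ i → 0ℚ ≤ χ i) → (∀ i → 0ℚ ≤ ψ i) →
    (∀ i → χ i + ψ i ≤ 1ℚ) → 4ℚ * ∑ (λ i → ∑ (λ j → χ i * ψ j)) ≤ ℕ→ℚ n * ℕ→ℚ n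
  4∑∑-disjoint≤n² {n} χ ψ 0≤χ 0≤ψ χ+ψ≤1 = begin
    4ℚ * ∑ (λ i → ∑ (λ j → χ i * ψ j))  ≡⟨ cong (4ℚ *_) (∑-* χ ψ) ⟩
    4ℚ * (∑ χ * ∑ ψ)                    ≤⟨ ≤-by _ (square-nonNeg (∑ χ - ∑ ψ)) (solve 2 (λ x y →
                                             (x :+ y) :* (x :+ y) := con 4ℚ :* (x :* y) :+ (x :- y) :* (x :- y)) refl (∑ χ) (∑ ψ)) ⟩
    (∑ χ + ∑ ψ) * (∑ χ + ∑ ψ)           ≤⟨ *-mono-≤ 0≤∑ (ℕ→ℚ-nonNeg n) ∑≤n ∑≤n ⟩
    ℕ→ℚ n * ℕ→ℚ n                       ∎
    where
    open ≤-Reasoning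
    0≤∑ : 0ℚ ≤ ∑ χ + ∑ ψ
    0≤∑ = +-mono-≤ (∑-nonNeg 0≤χ) (∑-nonNeg 0≤ψ)
    ∑≤n : ∑ χ + ∑ ψ ≤ ℕ→ℚ n
    ∑≤n = subst₂ _≤_ (∑-distrib-+ χ ψ) (trans (∑-const n 1ℚ) (*-identityʳ (ℕ→ℚ n))) (∑-mono χ+ψ≤1)

-- The Poincaré inequality of the hypergraph Laplacian.

module Poincaré where
  open import Data.Bool using (true; false)
  open import Data.Fin.Subset using (Subset) renaming (∣_∣ to card)
  open import Data.Fin.Subset.Properties using (_∈?_)
  open import Data.List using (List; []; _∷_; length; filter; map; foldr)
  open import Data.List.Extrema.Nat using (xs≤max)
  open import Data.List.Relation.Unary.All as All using (All; []; _∷_)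
  import Data.List.Relation.Unary.All.Properties as All
  open import Data.List.Relation.Unary.Any using (Any; here; there)
  open import Data.Nat as ℕ using (ℕ; suc)
  import Data.Nat.Properties as ℕ
  open import Data.Product using (_×_; _,_)
  open import Data.Rational
  open import Data.Rational.Properties
  open import Data.Rational.Solver using (module +-*-Solver)
  open import Data.Sum using (_⊎_; inj₁; inj₂)
  open import Data.Vec using ([]; _∷_)
  open import Defs using (ℕ→ℚ; invℚ; Hypergraph; Connected; IsDiameter; rank; degree; codegree; laplacian; seq)
  open import Relation.Binary.PropositionalEquality
  open import Relation.Nullary using (Dec; yes; no; ¬_; contradiction; _×-dec_)
  open +-*-Solver
  open Rationals
  open Walks using (Walk; []; _∷_; Adjacent; adjacent?; module Distance)

  ∑-∈ : ∀ {n} (e : Subset n) → ∑ (λ j → 𝟙 (j ∈? e)) ≡ ℕ→ℚ (card e)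
  ∑-∈ []          = refl
  ∑-∈ (true ∷ e)  = trans (cong (λ s → 1ℚ + s) (∑-∈ e)) (sym (ℕ→ℚ-suc (card e)))
  ∑-∈ (false ∷ e) = trans (+-identityˡ _) (∑-∈ e)

  ℕ→ℚ-pred-pos : ∀ {m} → 2 ℕ.≤ m → 0ℚ < ℕ→ℚ (m ℕ.∸ 1)
  ℕ→ℚ-pred-pos (ℕ.s≤s (ℕ.s≤s {n = k} _)) = ℕ→ℚ-pos k

  ℕ→ℚ-pred : ∀ {m} → 2 ℕ.≤ m → ℕ→ℚ m ≡ 1ℚ + ℕ→ℚ (m ℕ.∸ 1)
  ℕ→ℚ-pred (ℕ.s≤s {n = k} _) = ℕ→ℚ-suc k

  𝟙-× : ∀ {P Q : Set} (P? : Dec P) (Q? : Dec Q) → 𝟙 (P? ×-dec Q?) ≡ 𝟙 P? * 𝟙 Q?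
  𝟙-× (yes _) (yes _) = refl
  𝟙-× (yes _) (no _)  = refl
  𝟙-× (no _)  (yes _) = refl
  𝟙-× (no _)  (no _)  = refl

  𝟙-idem : ∀ {P : Set} (P? : Dec P) → 𝟙 P? * 𝟙 P? ≡ 𝟙 P?
  𝟙-idem (yes _) = refl
  𝟙-idem (no _)  = refl

  module _ {A : Set} {P : A → Set} (P? : ∀ x → Dec (P x)) where

    sumFilter-∷ : ∀ (w : A → ℚ) x xs → foldr _+_ 0ℚ (map w (filter P? (x ∷ xs))) ≡
      𝟙 (P? x) * w x + foldr _+_ 0ℚ (map w (filter P? xs))
    sumFilter-∷ w x xs with P? x
    ... | yes _ = cong (_+ foldr _+_ 0ℚ (map w (filter P? xs))) (sym (*-identityˡ (w x)))
    ... | no _  = sym (trans (cong (_+ foldr _+_ 0ℚ (map w (filter P? xs))) (*-zeroˡ (w x))) (+-identityˡ _))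

    lengthFilter-∷ : ∀ x xs → ℕ→ℚ (length (filter P? (x ∷ xs))) ≡ 𝟙 (P? x) + ℕ→ℚ (length (filter P? xs))
    lengthFilter-∷ x xs with P? x
    ... | yes _ = ℕ→ℚ-suc (length (filter P? xs))
    ... | no _  = sym (+-identityˡ (ℕ→ℚ (length (filter P? xs))))

    1≤length-filter : ∀ xs → Any P xs → 1 ℕ.≤ length (filter P? xs)
    1≤length-filter (x ∷ xs) (here p) with P? x
    ... | yes _ = ℕ.s≤s ℕ.z≤n
    ... | no ¬p = contradiction p ¬p
    1≤length-filter (x ∷ xs) (there ps) with P? x
    ... | yes _ = ℕ.s≤s ℕ.z≤n
    ... | no _  = 1≤length-filter xs ps

  -- Edge weights and codegrees.

  module _ {n : ℕ} where

    weight : Subset n → ℚ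
    weight e = invℚ (ℕ→ℚ (card e ℕ.∸ 1))

    weight-inverse : ∀ e → 2 ℕ.≤ card e → weight e * ℕ→ℚ (card e ℕ.∸ 1) ≡ 1ℚ
    weight-inverse e 2≤∣e∣ = invℚ-inverse (ℕ→ℚ-pred-pos 2≤∣e∣)

    weight-pos : ∀ e → 2 ℕ.≤ card e → 0ℚ < weight e
    weight-pos e 2≤∣e∣ = invℚ-pos (ℕ→ℚ-pred-pos 2≤∣e∣)

    weight-card : ∀ e → 2 ℕ.≤ card e → weight e * ℕ→ℚ (card e) ≡ 1ℚ + weight e
    weight-card e 2≤∣e∣ = begin
      weight e * ℕ→ℚ (card e)                           ≡⟨ cong (weight e *_) (ℕ→ℚ-pred 2≤∣e∣) ⟩
      weight e * (1ℚ + ℕ→ℚ (card e ℕ.∸ 1))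
        ≡⟨ solve 2 (λ w k → w :* (con 1ℚ :+ k) := w :* k :+ w) refl (weight e) (ℕ→ℚ (card e ℕ.∸ 1)) ⟩
      weight e * ℕ→ℚ (card e ℕ.∸ 1) + weight e          ≡⟨ cong (_+ weight e) (weight-inverse e 2≤∣e∣) ⟩
      1ℚ + weight e                                     ∎
      where open ≡-Reasoning

    sharing : List (Subset n) → Fin n → Fin n → List (Subset n)
    sharing es i j = filter (λ e → (i ∈? e) ×-dec (j ∈? e)) es

    -- At the edge list of `G` this is `codegree G` by definition; the arbitrary list permits
    -- induction on the edges.
    pairWeight : List (Subset n) → Fin n → Fin n → ℚ
    pairWeight es i j = foldr _+_ 0ℚ (map weight (sharing es i j))

    pairWeight-∷ : ∀ e es i j →
      pairWeight (e ∷ es) i j ≡ 𝟙 (i ∈? e) * 𝟙 (j ∈? e) * weight e + pairWeight es i j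
    pairWeight-∷ e es i j = trans
      (sumFilter-∷ (λ e → (i ∈? e) ×-dec (j ∈? e)) weight e es)
      (cong (λ x → x * weight e + pairWeight es i j) (𝟙-× (i ∈? e) (j ∈? e)))

    pairWeight-sym : ∀ es i j → pairWeight es i j ≡ pairWeight es j i
    pairWeight-sym []       i j = refl
    pairWeight-sym (e ∷ es) i j = begin
      pairWeight (e ∷ es) i j                                   ≡⟨ pairWeight-∷ e es i j ⟩
      𝟙 (i ∈? e) * 𝟙 (j ∈? e) * weight e + pairWeight es i j
        ≡⟨ cong₂ (λ x y → x * weight e + y) (*-comm (𝟙 (i ∈? e)) (𝟙 (j ∈? e))) (pairWeight-sym es i j) ⟩
      𝟙 (j ∈? e) * 𝟙 (i ∈? e) * weight e + pairWeight es j i    ≡⟨ pairWeight-∷ e es j i ⟨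
      pairWeight (e ∷ es) j i                                   ∎
      where open ≡-Reasoning

    -- Each edge e at i contributes |e| · 1/(|e| - 1) = 1 + 1/(|e| - 1).
    ∑-pairWeight : ∀ es → All (λ e → 2 ℕ.≤ card e) es → ∀ i →
      ∑ (pairWeight es i) ≡ ℕ→ℚ (length (filter (i ∈?_) es)) + pairWeight es i i
    ∑-pairWeight []       []           i = ∑-zero {n} (λ _ → refl)
    ∑-pairWeight (e ∷ es) (2≤∣e∣ ∷ ps) i = begin
      ∑ (pairWeight (e ∷ es) i)
        ≡⟨ sum-cong-≗ (λ j → trans (pairWeight-∷ e es i j)
             (cong (_+ pairWeight es i j) (solve 3 (λ x y z → x :* y :* z := (x :* z) :* y) refl χ (𝟙 (j ∈? e)) w))) ⟩
      ∑ (λ j → (χ * w) * 𝟙 (j ∈? e) + pairWeight es i j)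
        ≡⟨ ∑-distrib-+ (λ j → (χ * w) * 𝟙 (j ∈? e)) (pairWeight es i) ⟩
      ∑ (λ j → (χ * w) * 𝟙 (j ∈? e)) + ∑ (pairWeight es i)
        ≡⟨ cong₂ _+_ (trans (sym (*-distribˡ-sum (χ * w) (λ j → 𝟙 (j ∈? e)))) (cong (λ s → (χ * w) * s) (∑-∈ e)))
                     (∑-pairWeight es ps i) ⟩
      (χ * w) * ℕ→ℚ (card e) + (d + pairWeight es i i)
        ≡⟨ cong (_+ (d + pairWeight es i i)) (trans (*-assoc χ w _) (cong (χ *_) (weight-card e 2≤∣e∣))) ⟩
      χ * (1ℚ + w) + (d + pairWeight es i i)
        ≡⟨ solve 4 (λ x w d c → x :* (con 1ℚ :+ w) :+ (d :+ c) :=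
             (x :+ d) :+ (x :* w :+ c)) refl χ w d (pairWeight es i i) ⟩
      (χ + d) + (χ * w + pairWeight es i i)
        ≡⟨ cong₂ _+_ (sym (lengthFilter-∷ (i ∈?_) e es))
             (trans (cong (λ x → x * w + pairWeight es i i) (sym (𝟙-idem (i ∈? e)))) (sym (pairWeight-∷ e es i i))) ⟩
      ℕ→ℚ (length (filter (i ∈?_) (e ∷ es))) + pairWeight (e ∷ es) i i ∎
      where
      open ≡-Reasoning
      χ = 𝟙 (i ∈? e)
      w = weight e
      d = ℕ→ℚ (length (filter (i ∈?_) es))

    length≤*weights : ∀ {ρ} es → All (λ e → 1ℚ ≤ ρ * weight e) es →
      ℕ→ℚ (length es) ≤ ρ * foldr _+_ 0ℚ (map weight es)
    length≤*weights {ρ} []       []       = ≤-reflexive (sym (*-zeroʳ ρ))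
    length≤*weights {ρ} (e ∷ es) (p ∷ ps) = begin
      ℕ→ℚ (suc (length es))                                 ≡⟨ ℕ→ℚ-suc (length es) ⟩
      1ℚ + ℕ→ℚ (length es)                                  ≤⟨ +-mono-≤ p (length≤*weights {ρ} es ps) ⟩
      ρ * weight e + ρ * foldr _+_ 0ℚ (map weight es)       ≡⟨ *-distribˡ-+ ρ (weight e) _ ⟨
      ρ * (weight e + foldr _+_ 0ℚ (map weight es))         ∎
      where open ≤-Reasoning

  -- The Laplacian as that of a weighted graph.

  module _ {n : ℕ} (G : Hypergraph n) where
    open Hypergraph G

    -- The subtraction is rational, as in the denominator of the theorem, so `ρ` is -1 when there
    -- are no edges.
    ρ : ℚ
    ρ = ℕ→ℚ (rank G) - 1ℚ

    card≤rank : All (λ e → card e ℕ.≤ rank G) edges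
    card≤rank = All.map⁻ (xs≤max 0 (map card edges))

    -- The weight of `e` inverts |e| - 1, and |e| - 1 is at most `ρ`.
    1≤ρ*weight : All (λ e → 1ℚ ≤ ρ * weight e) edges
    1≤ρ*weight = All.zipWith (λ {e} (c , 2≤∣e∣) → bound e c 2≤∣e∣) (card≤rank , size≥2)
      where
      open ≤-Reasoning
      bound : ∀ e → card e ℕ.≤ rank G → 2 ℕ.≤ card e → 1ℚ ≤ ρ * weight e
      bound e ∣e∣≤r 2≤∣e∣ = begin
        1ℚ                                ≡⟨ weight-inverse e 2≤∣e∣ ⟨
        weight e * ℕ→ℚ (card e ℕ.∸ 1)
          ≡⟨ solve 2 (λ w k → w :* k := ((con 1ℚ :+ k) :- con 1ℚ) :* w) refl (weight e) (ℕ→ℚ (card e ℕ.∸ 1)) ⟩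
        (1ℚ + ℕ→ℚ (card e ℕ.∸ 1) - 1ℚ) * weight e  ≡⟨ cong (λ c → (c - 1ℚ) * weight e) (ℕ→ℚ-pred 2≤∣e∣) ⟨
        (ℕ→ℚ (card e) - 1ℚ) * weight e
          ≤⟨ *-monoʳ-≤ (weight e) (<⇒≤ (weight-pos e 2≤∣e∣)) (+-monoˡ-≤ (- 1ℚ) (ℕ→ℚ-mono ∣e∣≤r)) ⟩
        ρ * weight e                      ∎

    sharing≤ρ*codegree : ∀ i j → ℕ→ℚ (length (sharing edges i j)) ≤ ρ * codegree G i j
    sharing≤ρ*codegree i j =
      length≤*weights {ρ = ρ} (sharing edges i j) (All.filter⁺ (λ e → (i ∈? e) ×-dec (j ∈? e)) 1≤ρ*weight)

    0≤ρ*codegree : ∀ i j → 0ℚ ≤ ρ * codegree G i j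
    0≤ρ*codegree i j = ≤-trans (ℕ→ℚ-nonNeg (length (sharing edges i j))) (sharing≤ρ*codegree i j)

    adjacent⇒1≤ρ*codegree : ∀ i j → Adjacent G i j → 1ℚ ≤ ρ * codegree G i j
    adjacent⇒1≤ρ*codegree i j a =
      ≤-trans (ℕ→ℚ-mono {1} (1≤length-filter (λ e → (i ∈? e) ×-dec (j ∈? e)) edges a)) (sharing≤ρ*codegree i j)

    -- All entries of `laplacian G` are constant sequences, so index 0 carries the whole entry.
    laplacianℚ : Fin n → Fin n → ℚ
    laplacianℚ i j = seq (laplacian G i j) 0

    seq-laplacian : ∀ i j m → seq (laplacian G i j) m ≡ laplacianℚ i j
    seq-laplacian i j m with i Fin.≟ j
    ... | yes _ = refl
    ... | no _  = refl

    -- The diagonal codegree is added on both sides so that the diagonal matrix on the right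
    -- consists of full row sums of codegrees, by `∑-pairWeight`.
    laplacian+codegree : ∀ i j →
      laplacianℚ i j + codegree G i j ≡ 𝟙 (i Fin.≟ j) * (ℕ→ℚ (degree G i) + codegree G i i)
    laplacian+codegree i j with i Fin.≟ j
    ... | yes refl = sym (*-identityˡ (ℕ→ℚ (degree G i) + codegree G i i))
    ... | no _     = trans (+-inverseˡ (codegree G i j)) (sym (*-zeroˡ (ℕ→ℚ (degree G i) + codegree G i i)))

    -- `L` is the Laplacian of the graph whose edge weights are the codegrees; the diagonal codegree
    -- drops out because it multiplies `f i - f i`.
    laplacian-apply : ∀ (f : Fin n → ℚ) i → ∑ (λ j → laplacianℚ i j * f j) ≡ ∑ (λ j → codegree G i j * (f i - f j))
    laplacian-apply f i = begin
      ∑ (λ j → L j * f j)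
        ≡⟨ sum-cong-≗ (λ j → trans
             (solve 4 (λ l c x y → l :* y := (l :+ c) :* y :+ :- c :* y) refl (L j) (c j) (f i) (f j))
             (cong (λ z → z + - c j * f j) (trans (cong (_* f j) (laplacian+codegree i j)) (*-assoc (δ j) t (f j))))) ⟩
      ∑ (λ j → δ j * (t * f j) + - c j * f j)
        ≡⟨ ∑-distrib-+ (λ j → δ j * (t * f j)) (λ j → - c j * f j) ⟩
      ∑ (λ j → δ j * (t * f j)) + ∑ (λ j → - c j * f j)
        ≡⟨ cong (_+ ∑ (λ j → - c j * f j)) (trans (∑-δ i (λ j → t * f j))
             (trans (cong (_* f i) (sym (∑-pairWeight edges size≥2 i))) (*-distribʳ-sum (f i) c))) ⟩
      ∑ (λ j → c j * f i) + ∑ (λ j → - c j * f j)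
        ≡⟨ ∑-distrib-+ (λ j → c j * f i) (λ j → - c j * f j) ⟨
      ∑ (λ j → c j * f i + - c j * f j)
        ≡⟨ sum-cong-≗ (λ j → solve 3 (λ c x y → c :* x :+ :- c :* y := c :* (x :- y)) refl (c j) (f i) (f j)) ⟩
      ∑ (λ j → c j * (f i - f j)) ∎
      where
      open ≡-Reasoning
      L = laplacianℚ i
      c = codegree G i
      δ = λ j → 𝟙 (i Fin.≟ j)
      t = ℕ→ℚ (degree G i) + codegree G i i

    -- By symmetry of the codegree the summand is antisymmetric in `i` and `j`, so the double sum
    -- equals its own negative.
    ∑-laplacian : ∀ (f : Fin n → ℚ) → ∑ (λ i → ∑ (λ j → laplacianℚ i j * f j)) ≡ 0ℚ
    ∑-laplacian f = begin
      ∑ (λ i → ∑ (λ j → laplacianℚ i j * f j))       ≡⟨ sum-cong-≗ (laplacian-apply f) ⟩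
      S                                              ≡⟨ solve 1 (λ s → s := con ½ :* (s :+ s)) refl S ⟩
      ½ * (S + S)                                    ≡⟨ cong (λ z → ½ * (S + z)) (∑-comm d) ⟩
      ½ * (S + ∑ (λ i → ∑ (λ j → d j i)))            ≡⟨ cong (½ *_) (∑∑-distrib-+ d (λ i j → d j i)) ⟨
      ½ * ∑ (λ i → ∑ (λ j → d i j + d j i))          ≡⟨ cong (½ *_) (∑-zero λ i → ∑-zero λ j → antisymmetric i j) ⟩
      ½ * 0ℚ                                         ≡⟨ *-zeroʳ ½ ⟩
      0ℚ                                             ∎
      where
      open ≡-Reasoning
      d = λ i j → codegree G i j * (f i - f j)
      S = ∑ (λ i → ∑ (d i))
      antisymmetric : ∀ i j → d i j + d j i ≡ 0ℚ
      antisymmetric i j = trans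
        (cong (λ c → d i j + c * (f j - f i)) (pairWeight-sym edges j i))
        (solve 3 (λ c x y → c :* (x :- y) :+ c :* (y :- x) := con 0ℚ) refl (codegree G i j) (f i) (f j))

    -- Energy along a walk.

    traversals : ∀ {u v l} → Walk G u v l → Fin n → Fin n → ℚ
    traversals []                a b = 0ℚ
    traversals (_∷_ {u} {w} _ p) a b = 𝟙 (u Fin.≟ a) * 𝟙 (w Fin.≟ b) + traversals p a b

    energy : (Fin n → ℚ) → ∀ {u v l} → Walk G u v l → ℚ
    energy f []                = 0ℚ
    energy f (_∷_ {u} {w} _ p) = (f u - f w) * (f u - f w) + energy f p

    energy-nonNeg : ∀ (f : Fin n → ℚ) {u v l} (p : Walk G u v l) → 0ℚ ≤ energy f p
    energy-nonNeg f []                = ≤-refl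
    energy-nonNeg f (_∷_ {u} {w} _ p) = +-mono-≤ (square-nonNeg (f u - f w)) (energy-nonNeg f p)

    -- Turns a sum over the steps of one walk into a sum over all ordered pairs, whose range is
    -- independent of the walk. The sums over endpoints and over pairs can then be exchanged.
    energy-traversals : ∀ f {u v l} (p : Walk G u v l) →
      energy f p ≡ ∑ (λ a → ∑ (λ b → traversals p a b * ((f a - f b) * (f a - f b))))
    energy-traversals f [] =
      sym (∑-zero λ a → ∑-zero λ b → *-zeroˡ ((f a - f b) * (f a - f b)))
    energy-traversals f (_∷_ {u} {w} _ p) = begin
      g u w + energy f p
        ≡⟨ cong₂ _+_ (sym (trans (sum-cong-≗ λ a → sym (*-distribˡ-sum (δ a) (λ b → ε b * g a b)))
              (trans (∑-δ u (λ a → ∑ (λ b → ε b * g a b))) (∑-δ w (g u))))) (energy-traversals f p) ⟩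
      ∑ (λ a → ∑ (λ b → δ a * (ε b * g a b))) + ∑ (λ a → ∑ (λ b → traversals p a b * g a b))
        ≡⟨ ∑∑-distrib-+ (λ a b → δ a * (ε b * g a b)) (λ a b → traversals p a b * g a b) ⟨
      ∑ (λ a → ∑ (λ b → δ a * (ε b * g a b) + traversals p a b * g a b))
        ≡⟨ ∑∑-cong (λ a b → solve 4 (λ d e t g → d :* (e :* g) :+ t :* g := (d :* e :+ t) :* g) refl
             (δ a) (ε b) (traversals p a b) (g a b)) ⟩
      ∑ (λ a → ∑ (λ b → (δ a * ε b + traversals p a b) * g a b)) ∎
      where
      open ≡-Reasoning
      g = λ a b → (f a - f b) * (f a - f b)
      δ = λ a → 𝟙 (u Fin.≟ a)
      ε = λ b → 𝟙 (w Fin.≟ b)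

    -- Cauchy-Schwarz in a form that is additive along the walk: the left side telescopes, and each
    -- step uses 2 s t d ≤ t² + s² d². The parameters are chosen afterwards.
    energy-AMGM : ∀ f s t {u v l} (p : Walk G u v l) →
      2ℚ * (s * t * (f u - f v)) ≤ ℕ→ℚ l * (t * t) + s * s * energy f p
    energy-AMGM f s t {v = v} [] = ≤-reflexive (solve 3 (λ s t x →
      con 2ℚ :* (s :* t :* (x :- x)) := con 0ℚ :* (t :* t) :+ s :* s :* con 0ℚ) refl s t (f v))
    energy-AMGM f s t {v = v} {suc l} (_∷_ {u} {w} _ p) = begin
      2ℚ * (s * t * (f u - f v))
        ≡⟨ solve 5 (λ s t x y z → con 2ℚ :* (s :* t :* (x :- z)) :=
             con 2ℚ :* (s :* t :* (x :- y)) :+ con 2ℚ :* (s :* t :* (y :- z))) refl s t (f u) (f w) (f v) ⟩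
      2ℚ * (s * t * d) + 2ℚ * (s * t * (f w - f v))
        ≤⟨ +-mono-≤ amgm (energy-AMGM f s t p) ⟩
      (t * t + s * s * (d * d)) + (ℕ→ℚ l * (t * t) + s * s * energy f p)
        ≡⟨ solve 5 (λ s t d l e → (t :* t :+ s :* s :* (d :* d)) :+ (l :* (t :* t) :+ s :* s :* e) :=
             (con 1ℚ :+ l) :* (t :* t) :+ s :* s :* (d :* d :+ e)) refl s t d (ℕ→ℚ l) (energy f p) ⟩
      (1ℚ + ℕ→ℚ l) * (t * t) + s * s * (d * d + energy f p)
        ≡⟨ cong (λ x → x * (t * t) + s * s * (d * d + energy f p)) (ℕ→ℚ-suc l) ⟨
      ℕ→ℚ (suc l) * (t * t) + s * s * (d * d + energy f p) ∎
      where
      open ≤-Reasoning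
      d = f u - f w
      amgm : 2ℚ * (s * t * d) ≤ t * t + s * s * (d * d)
      amgm = ≤-by _ (square-nonNeg (t - s * d)) (solve 3 (λ s t d →
        t :* t :+ s :* s :* (d :* d) := con 2ℚ :* (s :* t :* d) :+ (t :- s :* d) :* (t :- s :* d)) refl s t d)

    square-difference≤energy : ∀ f {u v l} (p : Walk G u v l) → (f u - f v) * (f u - f v) ≤ ℕ→ℚ l * energy f p
    square-difference≤energy f {v = v} [] = ≤-reflexive (solve 1 (λ x → (x :- x) :* (x :- x) := con 0ℚ) refl (f v))
    square-difference≤energy f {u} {v} {suc l} p@(_ ∷ _) =
      *-cancelˡ-≤-pos L {{positive (ℕ→ℚ-pos l)}} (begin
        L * (y * y)
          ≡⟨ solve 2 (λ l y → l :* (y :* y) := con 2ℚ :* (l :* y :* y) :+ :- (l :* (y :* y))) refl L y ⟩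
        -- With `s = L` and `t = y` the estimate reads 2 L y² ≤ L y² + L² E; one L y² cancels.
        2ℚ * (L * y * y) + - (L * (y * y))                  ≤⟨ +-monoˡ-≤ (- (L * (y * y))) (energy-AMGM f L y p) ⟩
        L * (y * y) + L * L * E + - (L * (y * y))
          ≡⟨ solve 3 (λ l y e → l :* (y :* y) :+ l :* l :* e :+ :- (l :* (y :* y)) := l :* (l :* e)) refl L y E ⟩
        L * (L * E)                                         ∎)
      where
      open ≤-Reasoning
      L = ℕ→ℚ (suc l)
      y = f u - f v
      E = energy f p

    -- Congestion of the chosen geodesics.

    module _ (connected : Connected G) where
      open Distance G connected

      -- The last condition is the reverse triangle inequality, so it says that `a` lies on some
      -- geodesic from `u` to `v`.
      GeodesicStep : Fin n → Fin n → Fin n → Fin n → Set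
      GeodesicStep u v a b = Adjacent G a b × dist a v ≡ suc (dist b v) × dist u a ℕ.+ dist a v ℕ.≤ dist u v

      extend-step : ∀ {u w v l x} → Adjacent G u w → Walk G w v l → dist u v ≡ suc l → ∀ a →
        dist w a ℕ.+ x ℕ.≤ dist w v → dist u a ℕ.+ x ℕ.≤ dist u v
      extend-step {u} {w} {v} {l} {x} uw p d≡l a le = begin
        dist u a ℕ.+ x          ≤⟨ ℕ.+-monoˡ-≤ x (dist-adjacent a uw) ⟩
        suc (dist w a ℕ.+ x)    ≤⟨ ℕ.s≤s le ⟩
        suc (dist w v)          ≡⟨ cong suc (dist-tail uw p d≡l) ⟩
        suc l                   ≡⟨ d≡l ⟨
        dist u v                ∎
        where open ℕ.≤-Reasoning

      -- The distance to `v` strictly decreases along a geodesic, so no step is taken twice and the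
      -- count is 0 or 1.
      traversals-geodesic : ∀ {u v l} (p : Walk G u v l) → dist u v ≡ l → ∀ a b →
        traversals p a b ≡ 0ℚ ⊎ (traversals p a b ≡ 1ℚ × GeodesicStep u v a b)
      traversals-geodesic [] d≡l a b = inj₁ refl
      traversals-geodesic {v = v} {suc l} (_∷_ {u} {w} uw p) d≡l a b =
        split (u Fin.≟ a) (w Fin.≟ b) (traversals-geodesic p d′≡l a b)
        where
        T = traversals p a b
        d′≡l = dist-tail uw p d≡l
        Result : ℚ → Set
        Result t = t ≡ 0ℚ ⊎ (t ≡ 1ℚ × GeodesicStep u v a b)
        unchanged : T ≡ 0ℚ ⊎ (T ≡ 1ℚ × GeodesicStep w v a b) → Result (0ℚ + T)
        unchanged (inj₁ t≡0) = inj₁ (trans (+-identityˡ T) t≡0)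
        unchanged (inj₂ (t≡1 , ab , eq , le)) =
          inj₂ (trans (+-identityˡ T) t≡1 , ab , eq , extend-step uw p d≡l a le)
        split : (u≟a : Dec (u ≡ a)) (w≟b : Dec (w ≡ b)) →
          T ≡ 0ℚ ⊎ (T ≡ 1ℚ × GeodesicStep w v a b) → Result (𝟙 u≟a * 𝟙 w≟b + T)
        split (yes refl) (yes refl) (inj₁ t≡0) = inj₂
          ( cong (λ t → 1ℚ + t) t≡0 , uw , trans d≡l (cong suc (sym d′≡l))
          , ℕ.≤-reflexive (cong (ℕ._+ dist a v) (dist-self a)))
        -- A second use of the step in the tail would give dist a v ≤ dist w v, although `a` is the
        -- start of the walk and `w` is nearer to `v`.
        split (yes refl) (yes refl) (inj₂ (_ , _ , _ , le)) = contradiction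
          (ℕ.≤-trans (ℕ.m≤n+m (dist a v) (dist w a)) le)
          (ℕ.<⇒≱ (subst₂ ℕ._<_ (sym d′≡l) (sym d≡l) (ℕ.n<1+n l)))
        split (yes _) (no _)  = unchanged
        split (no _)  (yes _) = unchanged
        split (no _)  (no _)  = unchanged

      -- Compare the length of a geodesic through `a` with the detour through `b`: after cancelling
      -- `dist b v`, the triangle inequality leaves one unit.
      step-source : ∀ {u v a b} → GeodesicStep u v a b → dist u a ℕ.< dist u b
      step-source {u} {v} {a} {b} (_ , eq , le) = ℕ.+-cancelʳ-≤ (dist b v) _ _ (begin
        suc (dist u a) ℕ.+ dist b v      ≡⟨ ℕ.+-suc (dist u a) (dist b v) ⟨
        dist u a ℕ.+ suc (dist b v)      ≡⟨ cong (dist u a ℕ.+_) eq ⟨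
        dist u a ℕ.+ dist a v            ≤⟨ le ⟩
        dist u v                         ≤⟨ dist-triangle u b v ⟩
        dist u b ℕ.+ dist b v            ∎)
        where open ℕ.≤-Reasoning

      step-target : ∀ {u v a b} → GeodesicStep u v a b → dist v b ℕ.< dist v a
      step-target {u} {v} {a} {b} (_ , eq , _) =
        subst₂ ℕ._<_ (dist-sym b v) (trans (sym eq) (dist-sym a v)) (ℕ.n<1+n (dist b v))

      closer : Fin n → Fin n → Fin n → ℚ
      closer a b x = 𝟙 (dist x a ℕ.<? dist x b)

      closer-disjoint : ∀ a b x → closer a b x + closer b a x ≤ 1ℚ
      closer-disjoint a b x = split (dist x a ℕ.<? dist x b) (dist x b ℕ.<? dist x a)
        where
        split : (p : Dec (dist x a ℕ.< dist x b)) (q : Dec (dist x b ℕ.< dist x a)) → 𝟙 p + 𝟙 q ≤ 1ℚ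
        split (yes p) (yes q) = contradiction q (ℕ.<-asym p)
        split (yes _) (no _)  = ≤-refl
        split (no _)  (yes _) = ≤-refl
        split (no _)  (no _)  = <⇒≤ (positive⁻¹ 1ℚ)

      -- The pairs whose geodesic crosses a → b lie in the product of two disjoint vertex sets.
      traversals≤closer : ∀ u v a b → traversals (geodesic u v) a b ≤ closer a b u * closer b a v
      traversals≤closer u v a b with traversals-geodesic (geodesic u v) refl a b
      ... | inj₁ t≡0 = ≤-trans (≤-reflexive t≡0)
        (*-nonNeg (𝟙-nonNeg (dist u a ℕ.<? dist u b)) (𝟙-nonNeg (dist v b ℕ.<? dist v a)))
      ... | inj₂ (t≡1 , step) = ≤-reflexive (trans t≡1 (sym (cong₂ _*_
        (𝟙-true (dist u a ℕ.<? dist u b) (step-source step))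
        (𝟙-true (dist v b ℕ.<? dist v a) (step-target step)))))

      congestion : Fin n → Fin n → ℚ
      congestion a b = ∑ (λ u → ∑ (λ v → traversals (geodesic u v) a b))

      4*congestion≤n² : ∀ a b → 4ℚ * congestion a b ≤ ℕ→ℚ n * ℕ→ℚ n
      4*congestion≤n² a b = ≤-trans
        (*-monoˡ-≤ 4ℚ (ℕ→ℚ-nonNeg 4) (∑∑-mono λ u v → traversals≤closer u v a b))
        (4∑∑-disjoint≤n² (closer a b) (closer b a) (λ x → 𝟙-nonNeg (dist x a ℕ.<? dist x b))
          (λ x → 𝟙-nonNeg (dist x b ℕ.<? dist x a)) (closer-disjoint a b))

      non-adjacent⇒congestion≡0 : ∀ a b → ¬ Adjacent G a b → congestion a b ≡ 0ℚ
      non-adjacent⇒congestion≡0 a b ¬ab = ∑-zero λ u → ∑-zero λ v → vanish u v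
        where
        vanish : ∀ u v → traversals (geodesic u v) a b ≡ 0ℚ
        vanish u v with traversals-geodesic (geodesic u v) refl a b
        ... | inj₁ t≡0          = t≡0
        ... | inj₂ (_ , ab , _) = contradiction ab ¬ab

      -- For adjacent vertices the factor `ρ * codegree` is at least 1 and only enlarges the bound
      -- n². For other pairs the congestion vanishes, because geodesics step between adjacent
      -- vertices.
      4*congestion≤n²ρ*codegree : ∀ a b → 4ℚ * congestion a b ≤ ℕ→ℚ n * ℕ→ℚ n * (ρ * codegree G a b)
      4*congestion≤n²ρ*codegree a b = split (adjacent? G a b)
        where
        open ≤-Reasoning
        N² = ℕ→ℚ n * ℕ→ℚ n
        split : Dec (Adjacent G a b) → 4ℚ * congestion a b ≤ N² * (ρ * codegree G a b)
        split (yes ab) = begin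
          4ℚ * congestion a b           ≤⟨ 4*congestion≤n² a b ⟩
          N²                            ≡⟨ *-identityʳ N² ⟨
          N² * 1ℚ                       ≤⟨ *-monoˡ-≤ N² (square-nonNeg (ℕ→ℚ n)) (adjacent⇒1≤ρ*codegree a b ab) ⟩
          N² * (ρ * codegree G a b)     ∎
        split (no ¬ab) = begin
          4ℚ * congestion a b           ≡⟨ cong (4ℚ *_) (non-adjacent⇒congestion≡0 a b ¬ab) ⟩
          4ℚ * 0ℚ                       ≡⟨ *-zeroʳ 4ℚ ⟩
          0ℚ                            ≤⟨ *-nonNeg (square-nonNeg (ℕ→ℚ n)) (0≤ρ*codegree a b) ⟩
          N² * (ρ * codegree G a b)     ∎

      module _ {D : ℕ} (diameter : IsDiameter G D) (f : Fin n → ℚ) where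

        private
          g : Fin n → Fin n → ℚ
          g a b = (f a - f b) * (f a - f b)

          T : Fin n → Fin n → Fin n → Fin n → ℚ
          T u v = traversals (geodesic u v)

          N Dℚ : ℚ
          N  = ℕ→ℚ n
          Dℚ = ℕ→ℚ D

        square-difference≤diameter : ∀ u v → g u v ≤ Dℚ * ∑ (λ a → ∑ (λ b → T u v a b * g a b))
        square-difference≤diameter u v = begin
          g u v                                          ≤⟨ square-difference≤energy f (geodesic u v) ⟩
          ℕ→ℚ (dist u v) * energy f (geodesic u v)
            ≤⟨ *-monoʳ-≤ (energy f (geodesic u v)) (energy-nonNeg f (geodesic u v))
                                                              (ℕ→ℚ-mono (dist≤diameter diameter u v)) ⟩
          Dℚ * energy f (geodesic u v)                   ≡⟨ cong (Dℚ *_) (energy-traversals f (geodesic u v)) ⟩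
          Dℚ * ∑ (λ a → ∑ (λ b → T u v a b * g a b))     ∎
          where open ≤-Reasoning

        ∑-square-differences≤congestion : ∑ (λ u → ∑ (g u)) ≤ Dℚ * ∑ (λ a → ∑ (λ b → congestion a b * g a b))
        ∑-square-differences≤congestion = begin
          ∑ (λ u → ∑ (g u))
            ≤⟨ ∑∑-mono square-difference≤diameter ⟩
          ∑ (λ u → ∑ (λ v → Dℚ * ∑ (λ a → ∑ (λ b → T u v a b * g a b))))
            ≡⟨ ∑∑-distribˡ Dℚ (λ u v → ∑ (λ a → ∑ (λ b → T u v a b * g a b))) ⟨
          Dℚ * ∑ (λ u → ∑ (λ v → ∑ (λ a → ∑ (λ b → T u v a b * g a b))))
            ≡⟨ cong (Dℚ *_) (∑∑∑∑-swap (λ u v a b → T u v a b * g a b)) ⟩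
          Dℚ * ∑ (λ a → ∑ (λ b → ∑ (λ u → ∑ (λ v → T u v a b * g a b))))
            ≡⟨ cong (Dℚ *_) (∑∑-cong λ a b → ∑∑-distribʳ (g a b) (λ u v → T u v a b)) ⟨
          Dℚ * ∑ (λ a → ∑ (λ b → congestion a b * g a b)) ∎
          where open ≤-Reasoning

        -- The comparison of congestion with codegree is made pair by pair. The factor 2 comes from
        -- the Dirichlet form over ordered pairs and cancels in `poincaré`.
        4∑-square-differences≤laplacian :
          4ℚ * ∑ (λ u → ∑ (g u)) ≤ 2ℚ * (N * (Dℚ * N * ρ) * ∑ (λ i → f i * ∑ (λ j → laplacianℚ i j * f j)))
        4∑-square-differences≤laplacian = begin
          4ℚ * ∑ (λ u → ∑ (g u))
            ≤⟨ *-monoˡ-≤ 4ℚ (ℕ→ℚ-nonNeg 4) ∑-square-differences≤congestion ⟩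
          4ℚ * (Dℚ * S)
            ≡⟨ solve 2 (λ d s → con 4ℚ :* (d :* s) := d :* (con 4ℚ :* s)) refl Dℚ S ⟩
          Dℚ * (4ℚ * S)
            ≡⟨ cong (Dℚ *_) (∑∑-distribˡ 4ℚ (λ a b → congestion a b * g a b)) ⟩
          Dℚ * ∑ (λ a → ∑ (λ b → 4ℚ * (congestion a b * g a b)))
            ≤⟨ *-monoˡ-≤ Dℚ (ℕ→ℚ-nonNeg D) (∑∑-mono termwise) ⟩
          Dℚ * ∑ (λ a → ∑ (λ b → N * N * ρ * (codegree G a b * g a b)))
            ≡⟨ cong (Dℚ *_) (∑∑-distribˡ (N * N * ρ) (λ a b → codegree G a b * g a b)) ⟨
          Dℚ * (N * N * ρ * ∑ (λ a → ∑ (λ b → codegree G a b * g a b)))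
            ≡⟨ cong (λ s → Dℚ * (N * N * ρ * s)) (∑∑-weighted-square-differences (codegree G) (pairWeight-sym edges) f) ⟩
          Dℚ * (N * N * ρ * (2ℚ * ∑ (λ i → f i * ∑ (λ j → codegree G i j * (f i - f j)))))
            ≡⟨ cong (λ s → Dℚ * (N * N * ρ * (2ℚ * s))) (sum-cong-≗ λ i → cong (f i *_) (laplacian-apply f i)) ⟨
          Dℚ * (N * N * ρ * (2ℚ * Λ))
            ≡⟨ solve 4 (λ d n r l → d :* (n :* n :* r :* (con 2ℚ :* l)) :=
                 con 2ℚ :* (n :* (d :* n :* r) :* l)) refl Dℚ N ρ Λ ⟩
          2ℚ * (N * (Dℚ * N * ρ) * Λ) ∎
          where
          open ≤-Reasoning
          S = ∑ (λ a → ∑ (λ b → congestion a b * g a b))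
          Λ = ∑ (λ i → f i * ∑ (λ j → laplacianℚ i j * f j))
          termwise : ∀ a b → 4ℚ * (congestion a b * g a b) ≤ N * N * ρ * (codegree G a b * g a b)
          termwise a b = begin
            4ℚ * (congestion a b * g a b)                ≡⟨ *-assoc 4ℚ (congestion a b) (g a b) ⟨
            4ℚ * congestion a b * g a b
              ≤⟨ *-monoʳ-≤ (g a b) (square-nonNeg (f a - f b)) (4*congestion≤n²ρ*codegree a b) ⟩
            N * N * (ρ * codegree G a b) * g a b
              ≡⟨ solve 4 (λ m r c g → m :* (r :* c) :* g :=
                   m :* r :* (c :* g)) refl (N * N) ρ (codegree G a b) (g a b) ⟩
            N * N * ρ * (codegree G a b * g a b)         ∎

        -- Subtracting the squared sum makes the inequality valid for every `f`. This form is needed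
        -- for real vectors, whose rational approximations are orthogonal to the constants only in
        -- the limit.
        poincaré : 4ℚ * (N * ∑ (λ i → f i * f i) - ∑ f * ∑ f) ≤
          N * (Dℚ * N * ρ) * ∑ (λ i → f i * ∑ (λ j → laplacianℚ i j * f j))
        poincaré = *-cancelˡ-≤-pos 2ℚ {{positive (ℕ→ℚ-pos 1)}} (begin
          2ℚ * (4ℚ * V)                 ≡⟨ solve 1 (λ v → con 2ℚ :* (con 4ℚ :* v) := con 4ℚ :* (con 2ℚ :* v)) refl V ⟩
          4ℚ * (2ℚ * V)                 ≡⟨ cong (4ℚ *_) (∑∑-square-differences f) ⟨
          4ℚ * ∑ (λ u → ∑ (g u))        ≤⟨ 4∑-square-differences≤laplacian ⟩
          2ℚ * (N * (Dℚ * N * ρ) * ∑ (λ i → f i * ∑ (λ j → laplacianℚ i j * f j))) ∎)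
          where
          open ≤-Reasoning
          V = N * ∑ (λ i → f i * f i) - ∑ f * ∑ f

-- Null sequences of rationals.

module NullSequences where
  open import Data.Fin using (zero; suc)
  open import Data.Integer using (+_)
  open import Data.Nat as ℕ using (ℕ; zero; suc)
  import Data.Nat.Properties as ℕ
  open import Data.Product using (∃-syntax; _×_; _,_)
  open import Data.Rational
  open import Data.Rational.Properties
  open import Data.Rational.Solver using (module +-*-Solver)
  open import Data.Sum using (inj₁; inj₂)
  open import Defs using (Cauchy; invℚ)
  open import Relation.Binary.PropositionalEquality
  open import Relation.Nullary using (yes; no; ¬_; contradiction)
  open +-*-Solver
  open Rationals

  Eventually : (ℕ → Set) → Set
  Eventually P = ∃[ N ] (∀ m → N ℕ.≤ m → P m)

  eventually-map : ∀ {P Q : ℕ → Set} → (∀ m → P m → Q m) → Eventually P → Eventually Q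
  eventually-map f (N , p) = N , λ m N≤m → f m (p m N≤m)

  eventually-map₂ : ∀ {P Q R : ℕ → Set} → (∀ m → P m → Q m → R m) → Eventually P → Eventually Q → Eventually R
  eventually-map₂ f (M , p) (N , q) = M ℕ.⊔ N , λ m h →
    f m (p m (ℕ.m⊔n≤o⇒m≤o M N h)) (q m (ℕ.m⊔n≤o⇒n≤o M N h))

  -- On underlying sequences, `x ≈ y` is `Null` of the difference and `x #0` is `Apart`, both by
  -- definition.
  Null Bounded Apart : (ℕ → ℚ) → Set
  Null z    = ∀ ε → 0ℚ < ε → Eventually (λ m → ∣ z m ∣ ≤ ε)
  Bounded x = ∃[ B ] 0ℚ < B × Eventually (λ m → ∣ x m ∣ ≤ B)
  Apart x   = ∃[ δ ] 0ℚ < δ × Eventually (λ m → δ ≤ ∣ x m ∣)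

  halve : ∀ ε → ε * ½ + ε * ½ ≡ ε
  halve = solve 1 (λ e → e :* con ½ :+ e :* con ½ := e) refl

  half-pos : ∀ {ε} → 0ℚ < ε → 0ℚ < ε * ½
  half-pos 0<ε = *-pos 0<ε (positive⁻¹ ½)

  p≤∣p∣ : ∀ p → p ≤ ∣ p ∣
  p≤∣p∣ p with ≤-total 0ℚ p
  ... | inj₁ 0≤p = ≤-reflexive (sym (0≤p⇒∣p∣≡p 0≤p))
  ... | inj₂ p≤0 = ≤-trans p≤0 (0≤∣p∣ p)

  null-cong : ∀ {y z} → (∀ m → y m ≡ z m) → Null y → Null z
  null-cong y≡z ny ε 0<ε = eventually-map (λ m → subst (λ x → ∣ x ∣ ≤ ε) (y≡z m)) (ny ε 0<ε)

  null-0 : Null (λ _ → 0ℚ)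
  null-0 ε 0<ε = 0 , λ _ _ → <⇒≤ 0<ε

  null-+ : ∀ {y z} → Null y → Null z → Null (λ m → y m + z m)
  null-+ {y} {z} ny nz ε 0<ε = eventually-map₂
    (λ m p q → ≤-trans (∣p+q∣≤∣p∣+∣q∣ (y m) (z m)) (subst (∣ y m ∣ + ∣ z m ∣ ≤_) (halve ε) (+-mono-≤ p q)))
    (ny (ε * ½) (half-pos 0<ε)) (nz (ε * ½) (half-pos 0<ε))

  null-neg : ∀ {z} → Null z → Null (λ m → - z m)
  null-neg {z} nz ε 0<ε = eventually-map (λ m → subst (_≤ ε) (sym (∣-p∣≡∣p∣ (z m)))) (nz ε 0<ε)

  null-∑ : ∀ {n} (z : Fin n → ℕ → ℚ) → (∀ i → Null (z i)) → Null (λ m → ∑ (λ i → z i m))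
  null-∑ {zero}  z nz = null-0
  null-∑ {suc n} z nz = null-+ (nz zero) (null-∑ (λ i → z (suc i)) (λ i → nz (suc i)))

  null-* : ∀ {x z} → Bounded x → Null z → Null (λ m → x m * z m)
  null-* {x} {z} (B , 0<B , bx) nz ε 0<ε = eventually-map₂ bound bx (nz (ε * invℚ B) (*-pos 0<ε (invℚ-pos 0<B)))
    where
    open ≤-Reasoning
    bound : ∀ m → ∣ x m ∣ ≤ B → ∣ z m ∣ ≤ ε * invℚ B → ∣ x m * z m ∣ ≤ ε
    bound m p q = begin
      ∣ x m * z m ∣         ≡⟨ ∣p*q∣≡∣p∣*∣q∣ (x m) (z m) ⟩
      ∣ x m ∣ * ∣ z m ∣     ≤⟨ *-mono-≤ (0≤∣p∣ (z m)) (<⇒≤ 0<B) p q ⟩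
      B * (ε * invℚ B)      ≡⟨ solve 3 (λ b e r → b :* (e :* r) := e :* (r :* b)) refl B ε (invℚ B) ⟩
      ε * (invℚ B * B)      ≡⟨ cong (ε *_) (invℚ-inverse 0<B) ⟩
      ε * 1ℚ                ≡⟨ *-identityʳ ε ⟩
      ε                     ∎

  null⇒bounded : ∀ {z} → Null z → Bounded z
  null⇒bounded nz = 1ℚ , positive⁻¹ 1ℚ , nz 1ℚ (positive⁻¹ 1ℚ)

  bounded-const : ∀ c → Bounded (λ _ → c)
  bounded-const c = 1ℚ + ∣ c ∣ , +-mono-<-≤ (positive⁻¹ 1ℚ) (0≤∣p∣ c) , 0 , λ _ _ →
    ≤-by 1ℚ (<⇒≤ (positive⁻¹ 1ℚ)) (+-comm 1ℚ ∣ c ∣)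

  cauchy⇒bounded : ∀ {x} → Cauchy x → Bounded x
  cauchy⇒bounded {x} cx =
    let N , p = cx 1ℚ (positive⁻¹ 1ℚ)
    in 1ℚ + ∣ x N ∣ , +-mono-<-≤ (positive⁻¹ 1ℚ) (0≤∣p∣ (x N)) , N , λ m N≤m → begin
      ∣ x m ∣                     ≡⟨ cong ∣_∣ (solve 2 (λ a b → a := (a :- b) :+ b) refl (x m) (x N)) ⟩
      ∣ (x m - x N) + x N ∣       ≤⟨ ∣p+q∣≤∣p∣+∣q∣ (x m - x N) (x N) ⟩
      ∣ x m - x N ∣ + ∣ x N ∣     ≤⟨ +-monoˡ-≤ ∣ x N ∣ (p m N N≤m ℕ.≤-refl) ⟩
      1ℚ + ∣ x N ∣                ∎
    where open ≤-Reasoning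

  ≤+∣-∣ : ∀ p q {ε} → ∣ p - q ∣ ≤ ε → p ≤ q + ε
  ≤+∣-∣ p q {ε} h = begin
    p                 ≡⟨ solve 2 (λ a b → a := b :+ (a :- b)) refl p q ⟩
    q + (p - q)       ≤⟨ +-monoʳ-≤ q (≤-trans (p≤∣p∣ (p - q)) h) ⟩
    q + ε             ∎
    where open ≤-Reasoning

  ∣-∣≤+∣-∣ : ∀ p q {ε} → ∣ p - q ∣ ≤ ε → ∣ p ∣ ≤ ∣ q ∣ + ε
  ∣-∣≤+∣-∣ p q {ε} h = begin
    ∣ p ∣                     ≡⟨ cong ∣_∣ (solve 2 (λ a b → a := b :+ (a :- b)) refl p q) ⟩
    ∣ q + (p - q) ∣           ≤⟨ ∣p+q∣≤∣p∣+∣q∣ q (p - q) ⟩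
    ∣ q ∣ + ∣ p - q ∣         ≤⟨ +-monoʳ-≤ ∣ q ∣ h ⟩
    ∣ q ∣ + ε                 ∎
    where open ≤-Reasoning

  ⅓ : ℚ
  ⅓ = + 1 / 3

  third-pos : ∀ {ε} → 0ℚ < ε → 0ℚ < ε * ⅓
  third-pos 0<ε = *-pos 0<ε (positive⁻¹ ⅓)

  -- Tightness of apartness. From some index `N` on, the terms vary by at most ε/3, and the rational
  -- comparison of |x N| with 2ε/3 is decidable: either all later terms are at most ε, or all stay
  -- at least ε/3 away from 0.
  ¬apart⇒null : ∀ {x} → Cauchy x → ¬ Apart x → Null x
  ¬apart⇒null {x} cx ¬ax ε 0<ε with cx (ε * ⅓) (third-pos 0<ε)
  ... | N , p with ∣ x N ∣ ≤? ε * ⅓ + ε * ⅓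
  ...   | yes small = N , λ m N≤m → begin
    ∣ x m ∣                        ≤⟨ ∣-∣≤+∣-∣ (x m) (x N) (p m N N≤m ℕ.≤-refl) ⟩
    ∣ x N ∣ + ε * ⅓                ≤⟨ +-monoˡ-≤ (ε * ⅓) small ⟩
    ε * ⅓ + ε * ⅓ + ε * ⅓          ≡⟨ solve 1 (λ e → e :* con ⅓ :+ e :* con ⅓ :+ e :* con ⅓ := e) refl ε ⟩
    ε                              ∎
    where open ≤-Reasoning
  ...   | no large = contradiction (ε * ⅓ , third-pos 0<ε , N , away) ¬ax
    where
    open ≤-Reasoning
    away : ∀ m → N ℕ.≤ m → ε * ⅓ ≤ ∣ x m ∣
    away m N≤m = begin
      ε * ⅓                           ≡⟨ solve 1 (λ e → e := (e :+ e) :- e) refl (ε * ⅓) ⟩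
      ε * ⅓ + ε * ⅓ - ε * ⅓           ≤⟨ +-monoˡ-≤ (- (ε * ⅓)) (<⇒≤ (≰⇒> large)) ⟩
      ∣ x N ∣ - ε * ⅓                 ≤⟨ +-monoˡ-≤ (- (ε * ⅓)) (∣-∣≤+∣-∣ (x N) (x m) (p N m ℕ.≤-refl N≤m)) ⟩
      ∣ x m ∣ + ε * ⅓ - ε * ⅓         ≡⟨ solve 2 (λ a e → (a :+ e) :- e := a) refl ∣ x m ∣ (ε * ⅓) ⟩
      ∣ x m ∣                         ∎

  apart-*-null : ∀ {x y} → Apart x → Null (λ m → y m * x m) → Null y
  apart-*-null {x} {y} (δ , 0<δ , ax) nyx ε 0<ε = eventually-map₂ bound ax (nyx (ε * δ) (*-pos 0<ε 0<δ))
    where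
    open ≤-Reasoning
    bound : ∀ m → δ ≤ ∣ x m ∣ → ∣ y m * x m ∣ ≤ ε * δ → ∣ y m ∣ ≤ ε
    bound m p q = *-cancelʳ-≤-pos δ {{positive 0<δ}} (begin
      ∣ y m ∣ * δ             ≤⟨ *-monoˡ-≤ ∣ y m ∣ (0≤∣p∣ (y m)) p ⟩
      ∣ y m ∣ * ∣ x m ∣       ≡⟨ ∣p*q∣≡∣p∣*∣q∣ (y m) (x m) ⟨
      ∣ y m * x m ∣           ≤⟨ q ⟩
      ε * δ                   ∎)

  ∣p∣≤q-of-squares : ∀ {p q} → 0ℚ < q → p * p ≤ q * q → ∣ p ∣ ≤ q
  ∣p∣≤q-of-squares {p} {q} 0<q p²≤q² with ∣ p ∣ ≤? q
  ... | yes le = le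
  ... | no ¬le = contradiction p²≤q² (<⇒≱ (begin-strict
    q * q              <⟨ *-monoʳ-<-pos q {{positive 0<q}} q<∣p∣ ⟩
    q * ∣ p ∣          ≤⟨ *-monoʳ-≤ ∣ p ∣ (0≤∣p∣ p) (<⇒≤ q<∣p∣) ⟩
    ∣ p ∣ * ∣ p ∣      ≡⟨ ∣p∣²≡p² p ⟩
    p * p              ∎))
    where
    open ≤-Reasoning
    q<∣p∣ = ≰⇒> ¬le
    <⇒≱ : ∀ {a b} → a < b → ¬ b ≤ a
    <⇒≱ a<b b≤a = <-irrefl refl (<-≤-trans a<b b≤a)

  square-null : ∀ {x z η} → 0ℚ < η → Null z → Eventually (λ m → η * (x m * x m) ≤ z m) → Null x
  square-null {x} {z} {η} 0<η nz bound ε 0<ε = eventually-map₂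
    (λ m p q → ∣p∣≤q-of-squares 0<ε (*-cancelˡ-≤-pos η {{positive 0<η}} (≤-trans p (≤-trans (p≤∣p∣ (z m)) q))))
    bound (nz (η * (ε * ε)) (*-pos 0<η (*-pos 0<ε 0<ε)))

-- The lower bound on the second eigenvalue.

module SpectralGap where
  open import Data.Fin using (zero; suc)
  open import Data.Integer as ℤ using ()
  open import Data.Nat as ℕ using (ℕ; zero; suc)
  import Data.Nat.Properties as ℕ
  open import Data.Product using (_,_)
  open import Data.Rational
  open import Data.Rational.Properties
  open import Data.Rational.Solver using (module +-*-Solver)
  open import Defs as ℝ using (ℝ; seq; cauchy; invℚ; ℚ→ℝ; 0ℝ; Spectrum; IsEigenpair)
  open import Relation.Binary.PropositionalEquality
  open import Relation.Nullary using (yes; no; ¬_; contradiction)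
  open +-*-Solver
  open Rationals
  open NullSequences

  seq-sum : ∀ {n} (x : Fin n → ℝ) m → seq (ℝ.sum x) m ≡ ∑ (λ i → seq (x i) m)
  seq-sum {zero}  x m = refl
  seq-sum {suc n} x m = cong (λ s → seq (x zero) m + s) (seq-sum (λ i → x (suc i)) m)

  bounded-seq : ∀ x → Bounded (seq x)
  bounded-seq x = cauchy⇒bounded {seq x} (cauchy x)

  ≈0⇒null : ∀ x → x ℝ.≈ 0ℝ → Null (seq x)
  ≈0⇒null x x≈0 = null-cong (λ m → +-identityʳ (seq x m)) x≈0

  null⇒≈0 : ∀ x → Null (seq x) → x ℝ.≈ 0ℝ
  null⇒≈0 x nx = null-cong (λ m → sym (+-identityʳ (seq x m))) nx

  -- If the vector at `j` vanished, the Kronecker delta at `j` would be a vanishing combination, and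
  -- independence would force 1 ≈ 0.
  independent⇒nonzero : ∀ {n k} (v : Fin k → Fin n → ℝ) → ℝ.LinearlyIndependent v →
    ∀ j → ¬ (∀ i → Null (seq (v j i)))
  independent⇒nonzero v independent j vj≈0 =
    let N , p = ≈0⇒null (c j) (independent c combination j) ½ (positive⁻¹ ½)
    in contradiction (subst (λ q → ∣ q ∣ ≤ ½) (𝟙-true (j Fin.≟ j) refl) (p N ℕ.≤-refl)) λ { (*≤* (ℤ.+≤+ (ℕ.s≤s ()))) }
    where
    c = λ k → ℚ→ℝ (𝟙 (j Fin.≟ k))
    combination : ∀ i → ℝ.sum (λ k → c k ℝ.* v k i) ℝ.≈ 0ℝ
    combination i = null⇒≈0 (ℝ.sum (λ k → c k ℝ.* v k i)) (null-cong
      (λ m → sym (trans (seq-sum (λ k → c k ℝ.* v k i) m) (∑-δ j (λ k → seq (v k i) m)))) (vj≈0 i))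

  module _ {n : ℕ} (L : Fin n → Fin n → ℚ) where

    apply : (Fin n → ℚ) → Fin n → ℚ
    apply f i = ∑ (λ j → L i j * f j)

    apply-combination : ∀ a b f g i → apply (λ j → a * f j - b * g j) i ≡ a * apply f i - b * apply g i
    apply-combination a b f g i = begin
      ∑ (λ j → L i j * (a * f j - b * g j))
        ≡⟨ sum-cong-≗ (λ j → solve 5 (λ l a b x y → l :* (a :* x :- b :* y) :=
             a :* (l :* x) :+ (:- b) :* (l :* y)) refl (L i j) a b (f j) (g j)) ⟩
      ∑ (λ j → a * (L i j * f j) + (- b) * (L i j * g j))
        ≡⟨ ∑-distrib-+ (λ j → a * (L i j * f j)) (λ j → (- b) * (L i j * g j)) ⟩
      ∑ (λ j → a * (L i j * f j)) + ∑ (λ j → (- b) * (L i j * g j))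
        ≡⟨ cong₂ _+_ (sym (*-distribˡ-sum a (λ j → L i j * f j))) (sym (*-distribˡ-sum (- b) (λ j → L i j * g j))) ⟩
      a * apply f i + (- b) * apply g i
        ≡⟨ cong (λ z → a * apply f i + z) (sym (neg-distribˡ-* b (apply g i))) ⟩
      a * apply f i - b * apply g i ∎
      where open ≡-Reasoning

    ZeroColumnSums : Set
    ZeroColumnSums = ∀ f → ∑ (apply f) ≡ 0ℚ

    -- Used with `N = n` and `K = D n ρ`.
    PoincaréInequality : ℚ → ℚ → Set
    PoincaréInequality N K = ∀ f → 4ℚ * (N * ∑ (λ i → f i * f i) - ∑ f * ∑ f) ≤ N * K * ∑ (λ i → f i * apply f i)

    -- Here `κ` is an approximate Rayleigh quotient of `f` and `η` a gap below 4. Inserting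
    -- `K κ ≤ 4 - η` into the Poincaré inequality gives N η ‖f‖² ≤ 4 s² + N K z, where the sum `s`
    -- and the defect `z` tend to 0.
    low-rayleigh⇒null : ∀ {N K} → 0ℚ < N → PoincaréInequality N K →
      ∀ (f : ℕ → Fin n → ℚ) (κ : ℕ → ℚ) {η} → 0ℚ < η →
      Eventually (λ m → K * κ m ≤ 4ℚ - η) → Null (λ m → ∑ (f m)) →
      Null (λ m → ∑ (λ i → f m i * apply (f m) i) - κ m * ∑ (λ i → f m i * f m i)) →
      ∀ i → Null (λ m → f m i)
    low-rayleigh⇒null {N} {K} 0<N poincaré f κ {η} 0<η low ns nz i =
      square-null (*-pos 0<N 0<η) bound-null (eventually-map bound low)
      where
      open ≤-Reasoning
      s Q Λ z : ℕ → ℚ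
      s m = ∑ (f m)
      Q m = ∑ (λ i → f m i * f m i)
      Λ m = ∑ (λ i → f m i * apply (f m) i)
      z m = Λ m - κ m * Q m
      bound-null : Null (λ m → 4ℚ * (s m * s m) + N * K * z m)
      bound-null = null-+ (null-* (bounded-const 4ℚ) (null-* (null⇒bounded ns) ns)) (null-* (bounded-const (N * K)) nz)
      Q-nonNeg : ∀ m → 0ℚ ≤ Q m
      Q-nonNeg m = ∑-nonNeg λ i → square-nonNeg (f m i)
      bound : ∀ m → K * κ m ≤ 4ℚ - η → N * η * (f m i * f m i) ≤ 4ℚ * (s m * s m) + N * K * z m
      bound m le = begin
        N * η * (f m i * f m i)
          ≤⟨ *-monoˡ-≤ (N * η) (<⇒≤ (*-pos 0<N 0<η)) (term≤∑ (λ j → square-nonNeg (f m j)) i) ⟩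
        N * η * Q m
          ≡⟨ solve 4 (λ n e q s → n :* e :* q :=
               con 4ℚ :* (n :* q :- s :* s) :+ (con 4ℚ :* (s :* s) :+ :- ((con 4ℚ :- e) :* (n :* q)))) refl N η (Q m) (s m) ⟩
        4ℚ * (N * Q m - s m * s m) + (4ℚ * (s m * s m) + - ((4ℚ - η) * (N * Q m)))
          ≤⟨ +-mono-≤ (poincaré (f m)) (+-monoʳ-≤ (4ℚ * (s m * s m))
               (neg-antimono-≤ (*-monoʳ-≤ (N * Q m) (*-nonNeg (<⇒≤ 0<N) (Q-nonNeg m)) le))) ⟩
        N * K * Λ m + (4ℚ * (s m * s m) + - (K * κ m * (N * Q m)))
          ≡⟨ solve 6 (λ n k l s κ q → n :* k :* l :+ (con 4ℚ :* (s :* s) :+ :- (k :* κ :* (n :* q))) :=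
               con 4ℚ :* (s :* s) :+ n :* k :* (l :- κ :* q)) refl N K (Λ m) (s m) (κ m) (Q m) ⟩
        4ℚ * (s m * s m) + N * K * z m ∎

  Represents : ∀ {n} → (Fin n → Fin n → ℚ) → ℝ.Matrix n → Set
  Represents L M = ∀ i j m → seq (M i j) m ≡ L i j

  module Eigen {n : ℕ} (M : ℝ.Matrix n) (L : Fin n → Fin n → ℚ) (represents : Represents L M)
               (column-sums : ZeroColumnSums L)
               (μ : ℝ) (v : Fin n → ℝ) (eigenpair : IsEigenpair M μ v) where

    vₘ : ℕ → Fin n → ℚ
    vₘ m i = seq (v i) m

    -- The eigenvalue equation holds only in the limit; this is its defect at index `m`.
    residual : Fin n → ℕ → ℚ
    residual i m = apply L (vₘ m) i - seq μ m * vₘ m i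

    residual-null : ∀ i → Null (residual i)
    residual-null i = null-cong
      (λ m → cong (_- seq μ m * vₘ m i) (trans (seq-sum (λ j → M i j ℝ.* v j) m)
        (sum-cong-≗ λ j → cong (_* vₘ m j) (represents i j m))))
      (eigenpair i)

    ∑-residual : ∀ m → ∑ (λ i → residual i m) ≡ - (seq μ m * ∑ (vₘ m))
    ∑-residual m = begin
      ∑ (λ i → apply L (vₘ m) i + - (seq μ m * vₘ m i))
        ≡⟨ ∑-distrib-+ (apply L (vₘ m)) (λ i → - (seq μ m * vₘ m i)) ⟩
      ∑ (apply L (vₘ m)) + ∑ (λ i → - (seq μ m * vₘ m i))
        ≡⟨ cong₂ _+_ (column-sums (vₘ m)) (sum-cong-≗ λ i → neg-distribˡ-* (seq μ m) (vₘ m i)) ⟩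
      0ℚ + ∑ (λ i → (- seq μ m) * vₘ m i)
        ≡⟨ trans (+-identityˡ _) (sym (*-distribˡ-sum (- seq μ m) (vₘ m))) ⟩
      (- seq μ m) * ∑ (vₘ m)
        ≡⟨ neg-distribˡ-* (seq μ m) (∑ (vₘ m)) ⟨
      - (seq μ m * ∑ (vₘ m)) ∎
      where open ≡-Reasoning

    -- Summing the eigenvalue equation over all coordinates removes `L`, whose columns sum to 0, and
    -- leaves μ times the sum of `v`.
    μ*∑-null : Null (λ m → seq μ m * seq (ℝ.sum v) m)
    μ*∑-null = null-cong
      (λ m → trans (cong -_ (∑-residual m)) (trans
        (solve 1 (λ x → :- (:- x) := x) refl (seq μ m * ∑ (vₘ m)))
        (cong (seq μ m *_) (sym (seq-sum v m)))))
      (null-neg (null-∑ residual residual-null))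

    -- Pairing the residual with `v` keeps it null, since the coordinates of `v` are bounded.
    rayleigh-null : Null (λ m → ∑ (λ i → vₘ m i * apply L (vₘ m) i) - seq μ m * ∑ (λ i → vₘ m i * vₘ m i))
    rayleigh-null = null-cong expand
      (null-∑ (λ i m → vₘ m i * residual i m) (λ i → null-* {seq (v i)} {residual i} (bounded-seq (v i)) (residual-null i)))
      where
      open ≡-Reasoning
      expand : ∀ m → ∑ (λ i → vₘ m i * residual i m) ≡
        ∑ (λ i → vₘ m i * apply L (vₘ m) i) - seq μ m * ∑ (λ i → vₘ m i * vₘ m i)
      expand m = begin
        ∑ (λ i → vₘ m i * residual i m)
          ≡⟨ sum-cong-≗ (λ i → solve 3 (λ x l μ → x :* (l :- μ :* x) :=
               x :* l :+ (:- μ) :* (x :* x)) refl (vₘ m i) (apply L (vₘ m) i) (seq μ m)) ⟩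
        ∑ (λ i → vₘ m i * apply L (vₘ m) i + (- seq μ m) * (vₘ m i * vₘ m i))
          ≡⟨ ∑-distrib-+ (λ i → vₘ m i * apply L (vₘ m) i) (λ i → (- seq μ m) * (vₘ m i * vₘ m i)) ⟩
        ∑ (λ i → vₘ m i * apply L (vₘ m) i) + ∑ (λ i → (- seq μ m) * (vₘ m i * vₘ m i))
          ≡⟨ cong (λ z → ∑ (λ i → vₘ m i * apply L (vₘ m) i) + z)
               (trans (sym (*-distribˡ-sum (- seq μ m) (λ i → vₘ m i * vₘ m i))) (sym (neg-distribˡ-* (seq μ m) (∑ (λ i → vₘ m i * vₘ m i))))) ⟩
        ∑ (λ i → vₘ m i * apply L (vₘ m) i) - seq μ m * ∑ (λ i → vₘ m i * vₘ m i) ∎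

  module _ {n : ℕ} (M : ℝ.Matrix (suc (suc n))) (L : Fin (suc (suc n)) → Fin (suc (suc n)) → ℚ)
           (represents : Represents L M) (column-sums : ZeroColumnSums L)
           {N K : ℚ} (0<N : 0ℚ < N) (0≤K : 0ℚ ≤ K) (poincaré : PoincaréInequality L N K)
           (σ : Spectrum M) where
    open Spectrum σ

    private
      μ₀ μ₁ S₀ S₁ : ℝ
      μ₀ = eigenvalue zero
      μ₁ = eigenvalue (suc zero)
      S₀ = ℝ.sum (eigenvector zero)
      S₁ = ℝ.sum (eigenvector (suc zero))

      v₀ v₁ : Fin (suc (suc n)) → ℝ
      v₀ = eigenvector zero
      v₁ = eigenvector (suc zero)

      module E₀ = Eigen M L represents column-sums μ₀ v₀ (eigenpair zero)
      module E₁ = Eigen M L represents column-sums μ₁ v₁ (eigenpair (suc zero))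

    -- The order on reals allows an error at each index; half of the gap is spent on it.
    low-smallest : ∀ {η} → 0ℚ < η → Eventually (λ m → K * seq μ₁ m ≤ 4ℚ - η) →
      Eventually (λ m → K * seq μ₀ m ≤ 4ℚ - η * ½)
    low-smallest {η} 0<η low = eventually-map₂ bound low (ordered zero (suc zero) ℕ.z≤n ε 0<ε)
      where
      open ≤-Reasoning
      -- `K` may be 0, so the tolerance is obtained by dividing by `K + 1`.
      K+1 = K + 1ℚ
      0<K+1 : 0ℚ < K+1
      0<K+1 = +-mono-≤-< 0≤K (positive⁻¹ 1ℚ)
      ε = η * ½ * invℚ K+1
      0<ε : 0ℚ < ε
      0<ε = *-pos (half-pos 0<η) (invℚ-pos 0<K+1)
      Kε≤η/2 : K * ε ≤ η * ½
      Kε≤η/2 = begin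
        K * ε                       ≤⟨ *-monoʳ-≤ {K} {K+1} ε (<⇒≤ 0<ε) (≤-by 1ℚ (<⇒≤ (positive⁻¹ 1ℚ)) refl) ⟩
        K+1 * ε
          ≡⟨ solve 3 (λ k e r → k :* (e :* r) := e :* (r :* k)) refl K+1 (η * ½) (invℚ K+1) ⟩
        η * ½ * (invℚ K+1 * K+1)    ≡⟨ cong (λ z → η * ½ * z) (invℚ-inverse 0<K+1) ⟩
        η * ½ * 1ℚ                  ≡⟨ *-identityʳ (η * ½) ⟩
        η * ½                       ∎
      bound : ∀ m → K * seq μ₁ m ≤ 4ℚ - η → seq μ₀ m ≤ seq μ₁ m + ε → K * seq μ₀ m ≤ 4ℚ - η * ½
      bound m p q = begin
        K * seq μ₀ m                ≤⟨ *-monoˡ-≤ K 0≤K q ⟩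
        K * (seq μ₁ m + ε)          ≡⟨ *-distribˡ-+ K (seq μ₁ m) ε ⟩
        K * seq μ₁ m + K * ε        ≤⟨ +-mono-≤ p Kε≤η/2 ⟩
        4ℚ - η + η * ½              ≡⟨ solve 1 (λ e → con 4ℚ :- e :+ e :* con ½ := con 4ℚ :- e :* con ½) refl η ⟩
        4ℚ - η * ½                  ∎

    -- An eigenvector orthogonal to the constants with such an eigenvalue would vanish by
    -- `low-rayleigh⇒null`, against independence.
    low⇒∑-nonnull : ∀ j {η} → 0ℚ < η → Eventually (λ m → K * seq (eigenvalue j) m ≤ 4ℚ - η) →
      ¬ Null (seq (ℝ.sum (eigenvector j)))
    low⇒∑-nonnull j 0<η low ns = independent⇒nonzero eigenvector independent j
      (low-rayleigh⇒null L {N} {K} 0<N poincaré E.vₘ (seq (eigenvalue j)) 0<η low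
        (null-cong (seq-sum (eigenvector j)) ns) E.rayleigh-null)
      where module E = Eigen M L represents column-sums (eigenvalue j) (eigenvector j) (eigenpair j)

    -- If the two smallest eigenvalues vanish, w = S₁ v₀ - S₀ v₁ is a kernel vector orthogonal
    -- to the constants, so the Poincaré inequality kills it.
    kernel-simple : Null (seq μ₀) → Null (seq μ₁) → Null (seq S₁)
    -- Once `w` vanishes, independence annihilates its coefficient at `v₀`, which is `S₁`.
    kernel-simple nμ₀ nμ₁ = ≈0⇒null S₁ (independent c combination zero)
      where
      s₀ s₁ : ℕ → ℚ
      s₀ = seq S₀
      s₁ = seq S₁
      W : Fin (suc (suc n)) → ℝ
      W i = S₁ ℝ.* v₀ i ℝ.- S₀ ℝ.* v₁ i
      w : ℕ → Fin (suc (suc n)) → ℚ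
      w m i = s₁ m * E₀.vₘ m i - s₀ m * E₁.vₘ m i
      c : Fin (suc (suc n)) → ℝ
      c zero          = S₁
      c (suc zero)    = ℝ.- S₀
      c (suc (suc _)) = 0ℝ

      ∑w≡0 : ∀ m → 0ℚ ≡ ∑ (w m)
      ∑w≡0 m = sym (begin
        ∑ (λ i → s₁ m * E₀.vₘ m i - s₀ m * E₁.vₘ m i)
          ≡⟨ sum-cong-≗ (λ i → cong (λ z → s₁ m * E₀.vₘ m i + z) (neg-distribˡ-* (s₀ m) (E₁.vₘ m i))) ⟩
        ∑ (λ i → s₁ m * E₀.vₘ m i + (- s₀ m) * E₁.vₘ m i)
          ≡⟨ ∑-distrib-+ (λ i → s₁ m * E₀.vₘ m i) (λ i → (- s₀ m) * E₁.vₘ m i) ⟩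
        ∑ (λ i → s₁ m * E₀.vₘ m i) + ∑ (λ i → (- s₀ m) * E₁.vₘ m i)
          ≡⟨ cong₂ _+_ (*-distribˡ-sum (s₁ m) (E₀.vₘ m)) (*-distribˡ-sum (- s₀ m) (E₁.vₘ m)) ⟨
        s₁ m * ∑ (E₀.vₘ m) + (- s₀ m) * ∑ (E₁.vₘ m)
          ≡⟨ cong₂ (λ x y → s₁ m * x + (- s₀ m) * y) (seq-sum v₀ m) (seq-sum v₁ m) ⟨
        s₁ m * s₀ m + (- s₀ m) * s₁ m
          ≡⟨ solve 2 (λ a b → a :* b :+ (:- b) :* a := con 0ℚ) refl (s₁ m) (s₀ m) ⟩
        0ℚ ∎)
        where open ≡-Reasoning

      apply-null : ∀ i → Null (λ m → apply L (w m) i)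
      apply-null i = null-cong
        (λ m → trans
          -- Each image under `L` is its residual plus an eigenvalue multiple; both parts are null
          -- and stay null when multiplied by the bounded sums.
          (solve 8 (λ s₁ s₀ l₀ l₁ μ₀ μ₁ x y →
            s₁ :* ((l₀ :- μ₀ :* x) :+ x :* μ₀) :+ :- (s₀ :* ((l₁ :- μ₁ :* y) :+ y :* μ₁)) := s₁ :* l₀ :- s₀ :* l₁) refl
            (s₁ m) (s₀ m) (apply L (E₀.vₘ m) i) (apply L (E₁.vₘ m) i) (seq μ₀ m) (seq μ₁ m) (E₀.vₘ m i) (E₁.vₘ m i))
          (sym (apply-combination L (s₁ m) (s₀ m) (E₀.vₘ m) (E₁.vₘ m) i)))
        (null-+
          (null-* {s₁} {λ m → E₀.residual i m + E₀.vₘ m i * seq μ₀ m} (bounded-seq S₁)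
            (null-+ {E₀.residual i} (E₀.residual-null i) (null-* {seq (v₀ i)} {seq μ₀} (bounded-seq (v₀ i)) nμ₀)))
          (null-neg (null-* {s₀} {λ m → E₁.residual i m + E₁.vₘ m i * seq μ₁ m} (bounded-seq S₀)
            (null-+ {E₁.residual i} (E₁.residual-null i) (null-* {seq (v₁ i)} {seq μ₁} (bounded-seq (v₁ i)) nμ₁)))))

      w-null : ∀ i → Null (λ m → w m i)
      -- With `κ = 0` and `η = 4` the smallness condition reads K · 0 ≤ 4 - 4.
      w-null = low-rayleigh⇒null L {N} {K} 0<N poincaré w (λ _ → 0ℚ) (ℕ→ℚ-pos 3)
        (0 , λ _ _ → ≤-reflexive (*-zeroʳ K)) (null-cong ∑w≡0 null-0)
        (null-cong (λ m → sym (trans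
            (cong (λ z → ∑ (λ i → w m i * apply L (w m) i) - z) (*-zeroˡ (∑ (λ i → w m i * w m i))))
            (+-identityʳ (∑ (λ i → w m i * apply L (w m) i)))))
          (null-∑ (λ i m → w m i * apply L (w m) i)
            (λ i → null-* {λ m → w m i} {λ m → apply L (w m) i} (bounded-seq (W i)) (apply-null i))))

      combination : ∀ i → ℝ.sum (λ j → c j ℝ.* eigenvector j i) ℝ.≈ 0ℝ
      combination i = null⇒≈0 (ℝ.sum (λ j → c j ℝ.* eigenvector j i)) (null-cong expand (w-null i))
        where
        open ≡-Reasoning
        expand : ∀ m → w m i ≡ seq (ℝ.sum (λ j → c j ℝ.* eigenvector j i)) m
        expand m = begin
          s₁ m * x - s₀ m * y
            ≡⟨ solve 4 (λ a b x y → a :* x :- b :* y := a :* x :+ ((:- b) :* y :+ con 0ℚ)) refl (s₁ m) (s₀ m) x y ⟩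
          s₁ m * x + ((- s₀ m) * y + 0ℚ)
            ≡⟨ cong (λ z → s₁ m * x + ((- s₀ m) * y + z)) (∑-zero λ j → *-zeroˡ (seq (eigenvector (suc (suc j)) i) m)) ⟨
          ∑ (λ j → seq (c j ℝ.* eigenvector j i) m)   ≡⟨ seq-sum (λ j → c j ℝ.* eigenvector j i) m ⟨
          seq (ℝ.sum (λ j → c j ℝ.* eigenvector j i)) m ∎
          where
          x = E₀.vₘ m i
          y = E₁.vₘ m i

    -- If the sum were apart from 0, it could be cancelled from `μ*∑-null`. Failure to be null gives
    -- apartness only up to double negation.
    ∑-nonnull⇒¬¬μ-null : ∀ j → ¬ Null (seq (ℝ.sum (eigenvector j))) → ¬ ¬ Null (seq (eigenvalue j))
    ∑-nonnull⇒¬¬μ-null j ¬ns ¬nμ = ¬ns (¬apart⇒null (cauchy (ℝ.sum (eigenvector j)))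
      λ apart → ¬nμ (apart-*-null {seq (ℝ.sum (eigenvector j))} {seq (eigenvalue j)} apart E.μ*∑-null))
      where module E = Eigen M L represents column-sums (eigenvalue j) (eigenvector j) (eigenpair j)

    -- The goal is a negation, so both double negations may be opened: the two eigenvalues vanish,
    -- and `kernel-simple` then makes the sum of `v₁` null, which `low⇒∑-nonnull` forbids.
    ¬low : ∀ {η} → 0ℚ < η → ¬ Eventually (λ m → K * seq μ₁ m ≤ 4ℚ - η)
    ¬low 0<η low =
      ∑-nonnull⇒¬¬μ-null zero (low⇒∑-nonnull zero (half-pos 0<η) (low-smallest 0<η low)) λ nμ₀ →
      ∑-nonnull⇒¬¬μ-null (suc zero) ¬ns₁ λ nμ₁ →
      ¬ns₁ (kernel-simple nμ₀ nμ₁)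
      where
      ¬ns₁ : ¬ Null (seq S₁)
      ¬ns₁ = low⇒∑-nonnull (suc zero) 0<η low

    -- Once K μ₁ varies by at most ε/3, one rational comparison with 4 - 2ε/3 decides the matter.
    -- Below it, all later terms are at most 4 - ε/3, which `¬low` excludes; above it, all later
    -- terms exceed 4 - ε.
    K*μ₁≥4 : ∀ ε → 0ℚ < ε → Eventually (λ m → 4ℚ ≤ K * seq μ₁ m + ε)
    K*μ₁≥4 ε 0<ε with cauchy (ℚ→ℝ K ℝ.* μ₁) (ε * ⅓) (third-pos 0<ε)
    ... | M , close with K * seq μ₁ M ≤? 4ℚ - (ε * ⅓ + ε * ⅓)
    ...   | yes low = contradiction (M , λ m M≤m → begin
      K * seq μ₁ m                          ≤⟨ ≤+∣-∣ (K * seq μ₁ m) (K * seq μ₁ M) (close m M M≤m ℕ.≤-refl) ⟩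
      K * seq μ₁ M + ε * ⅓                  ≤⟨ +-monoˡ-≤ (ε * ⅓) low ⟩
      4ℚ - (ε * ⅓ + ε * ⅓) + ε * ⅓          ≡⟨ solve 1 (λ e → con 4ℚ :- (e :+ e) :+ e := con 4ℚ :- e) refl (ε * ⅓) ⟩
      4ℚ - ε * ⅓                            ∎) (¬low (third-pos 0<ε))
      where open ≤-Reasoning
    ...   | no high = M , λ m M≤m → begin
      4ℚ
        ≡⟨ solve 1 (λ e → con 4ℚ := con 4ℚ :- (e :+ e) :+ (e :+ e)) refl (ε * ⅓) ⟩
      4ℚ - (ε * ⅓ + ε * ⅓) + (ε * ⅓ + ε * ⅓)      ≤⟨ +-monoˡ-≤ (ε * ⅓ + ε * ⅓) (<⇒≤ (≰⇒> high)) ⟩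
      K * seq μ₁ M + (ε * ⅓ + ε * ⅓)
        ≤⟨ +-monoˡ-≤ (ε * ⅓ + ε * ⅓) (≤+∣-∣ (K * seq μ₁ M) (K * seq μ₁ m) (close M m ℕ.≤-refl M≤m)) ⟩
      K * seq μ₁ m + ε * ⅓ + (ε * ⅓ + ε * ⅓)
        ≡⟨ solve 2 (λ k e → k :+ e :* con ⅓ :+ (e :* con ⅓ :+ e :* con ⅓) := k :+ e) refl (K * seq μ₁ m) ε ⟩
      K * seq μ₁ m + ε                            ∎
      where open ≤-Reasoning

-- From a product bound to a quotient bound.

module Quotient where
  open import Data.Integer as ℤ using ()
  open import Data.Nat as ℕ using (ℕ; zero; suc)
  import Data.Nat.Properties as ℕ
  open import Data.Product using (_,_; Σ-syntax)
  open import Data.Rational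
  open import Data.Rational.Properties
  open import Data.Rational.Solver using (module +-*-Solver)
  open import Defs as ℝ using (ℝ; seq; ℕ→ℚ; invℚ; ℕ→ℝ; _#0; divide)
  open import Relation.Binary.PropositionalEquality
  open import Relation.Nullary using (contradiction)
  open +-*-Solver
  open Rationals
  open NullSequences

  divide-4≤ : ∀ d x → (∀ ε → 0ℚ < ε → Eventually (λ m → 4ℚ ≤ ℕ→ℚ d * seq x m + ε)) →
    Σ[ x#0 ∈ x #0 ] divide (ℕ→ℝ 4) x x#0 ℝ.≤ ℕ→ℝ d
  divide-4≤ zero x bound =
    -- For `d = 0` and tolerance 1 the bound would read 4 ≤ 0 + 1.
    let M , p = bound 1ℚ (positive⁻¹ 1ℚ)
    in contradiction (subst (4ℚ ≤_) (cong (_+ 1ℚ) (*-zeroˡ (seq x M))) (p M ℕ.≤-refl))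
         λ { (*≤* (ℤ.+≤+ (ℕ.s≤s ()))) }
  divide-4≤ (suc k) x bound = x#0 , quotient≤
    where
    open ≤-Reasoning
    d q : ℚ
    d = ℕ→ℚ (suc k)
    q = invℚ d
    0<d : 0ℚ < d
    0<d = ℕ→ℚ-pos k
    0<q : 0ℚ < q
    0<q = invℚ-pos 0<d

    -- Tolerance 3 leaves d x ≥ 1, which bounds `x` below by 1/d and supplies the apartness witness.
    q≤x : ∀ m → 4ℚ ≤ d * seq x m + ℕ→ℚ 3 → q ≤ seq x m
    q≤x m p = begin
      q                                 ≡⟨ solve 1 (λ q → q := q :* (con 4ℚ :- con (ℕ→ℚ 3))) refl q ⟩
      q * (4ℚ - ℕ→ℚ 3)                  ≤⟨ *-monoˡ-≤ q (<⇒≤ 0<q) (+-monoˡ-≤ (- ℕ→ℚ 3) p) ⟩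
      q * (d * seq x m + ℕ→ℚ 3 - ℕ→ℚ 3)
        ≡⟨ solve 3 (λ q d x → q :* (d :* x :+ con (ℕ→ℚ 3) :- con (ℕ→ℚ 3)) := q :* d :* x) refl q d (seq x m) ⟩
      q * d * seq x m                   ≡⟨ cong (_* seq x m) (invℚ-inverse 0<d) ⟩
      1ℚ * seq x m                      ≡⟨ *-identityˡ (seq x m) ⟩
      seq x m                           ∎

    eventually-q≤x : Eventually (λ m → q ≤ seq x m)
    eventually-q≤x = eventually-map q≤x (bound (ℕ→ℚ 3) (ℕ→ℚ-pos 2))

    x#0 : x #0
    x#0 = q , 0<q , eventually-map (λ m q≤ → ≤-trans q≤ (p≤∣p∣ (seq x m))) eventually-q≤x

    quotient≤ : divide (ℕ→ℝ 4) x x#0 ℝ.≤ ℕ→ℝ (suc k)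
    -- The tolerance ε q is at most ε x because `q ≤ x`, so division by `x` leaves an error of ε.
    quotient≤ ε 0<ε = eventually-map₂ estimate eventually-q≤x (bound (ε * q) (*-pos 0<ε 0<q))
      where
      estimate : ∀ m → q ≤ seq x m → 4ℚ ≤ d * seq x m + ε * q → 4ℚ * invℚ (seq x m) ≤ d + ε
      estimate m q≤ p = begin
        4ℚ * r
          ≤⟨ *-monoʳ-≤ r (<⇒≤ (invℚ-pos 0<y)) (≤-trans p (+-monoʳ-≤ (d * y) (*-monoˡ-≤ ε (<⇒≤ 0<ε) q≤))) ⟩
        (d * y + ε * y) * r
          ≡⟨ solve 4 (λ d e y r → (d :* y :+ e :* y) :* r := (d :+ e) :* (r :* y)) refl d ε y r ⟩
        (d + ε) * (r * y)           ≡⟨ cong ((d + ε) *_) (invℚ-inverse 0<y) ⟩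
        (d + ε) * 1ℚ                ≡⟨ *-identityʳ (d + ε) ⟩
        d + ε                       ∎
        where
        y = seq x m
        r = invℚ y
        0<y = <-≤-trans 0<q q≤

-- The spectral bound applied to a hypergraph.

module DiameterBound where
  import Data.List.Relation.Unary.All as All
  open import Data.Fin using (zero; suc)
  open import Data.Nat as ℕ using (ℕ; zero; suc)
  import Data.Nat.Properties as ℕ
  open import Data.Product using (_,_)
  open import Data.Rational
  open import Data.Rational.Properties
  open import Data.Rational.Solver using (module +-*-Solver)
  open import Defs using (Hypergraph; Connected; IsDiameter; Path; rank; laplacian; Spectrum; seq; ℕ→ℚ)
  open import Relation.Binary.PropositionalEquality
  open import Relation.Nullary using (contradiction)
  open +-*-Solver
  open Rationals
  open NullSequences using (Eventually; eventually-map)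
  open Poincaré
  open SpectralGap

  -- A path between two distinct vertices contains an edge, and its size forces the rank to be at
  -- least 2.
  ρ-nonNeg : ∀ {n} (G : Hypergraph (suc (suc n))) → Connected G → 0ℚ ≤ ρ G
  ρ-nonNeg G connected with connected zero (suc zero)
  ... | zero  , P = contradiction (trans (sym (Path.source P)) (Path.target P)) λ ()
  ... | suc l , P = ≤-by (ℕ→ℚ (rank G ℕ.∸ 1)) (ℕ→ℚ-nonNeg (rank G ℕ.∸ 1)) (begin
    ℕ→ℚ (rank G) - 1ℚ                   ≡⟨ cong (_- 1ℚ) (ℕ→ℚ-pred 2≤rank) ⟩
    1ℚ + ℕ→ℚ (rank G ℕ.∸ 1) - 1ℚ
      ≡⟨ solve 1 (λ x → con 1ℚ :+ x :- con 1ℚ := con 0ℚ :+ x) refl (ℕ→ℚ (rank G ℕ.∸ 1)) ⟩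
    0ℚ + ℕ→ℚ (rank G ℕ.∸ 1)             ∎)
    where
    open ≡-Reasoning
    e∈ = Path.edge∈ P zero
    2≤rank : 2 ℕ.≤ rank G
    2≤rank = ℕ.≤-trans (All.lookup (Hypergraph.size≥2 G) e∈) (All.lookup (card≤rank G) e∈)

  diameter*λ₂≥4 : ∀ {n} (G : Hypergraph (suc (suc n))) → Connected G → ∀ D → IsDiameter G D →
    (σ : Spectrum (laplacian G)) → ∀ ε → 0ℚ < ε →
    Eventually (λ m → 4ℚ ≤ ℕ→ℚ D * (ℕ→ℚ (suc (suc n)) * ρ G * seq (Spectrum.eigenvalue σ (suc zero)) m) + ε)
  diameter*λ₂≥4 {n} G connected D diameter σ ε 0<ε = eventually-map
    (λ m → subst (λ x → 4ℚ ≤ x + ε)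
      -- Regrouping isolates the diameter; the remaining factor is, term by term, the sequence of
      -- the denominator in the theorem.
      (solve 4 (λ d n r μ → d :* n :* r :* μ := d :* (n :* r :* μ)) refl
        (ℕ→ℚ D) (ℕ→ℚ (suc (suc n))) (ρ G) (seq (Spectrum.eigenvalue σ (suc zero)) m)))
    (K*μ₁≥4 (laplacian G) (laplacianℚ G) (seq-laplacian G) (∑-laplacian G)
      (ℕ→ℚ-pos (suc n)) (*-nonNeg (*-nonNeg (ℕ→ℚ-nonNeg D) (ℕ→ℚ-nonNeg (suc (suc n)))) (ρ-nonNeg G connected))
      (poincaré G connected diameter) σ ε 0<ε)

open import Defs
open import Data.Nat as ℕ using (ℕ)
open import Data.Product using (Σ-syntax)
open DiameterBound using (diameter*λ₂≥4)
open Quotient using (divide-4≤)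

theorem9 : ∀ {n : ℕ} (G : Hypergraph n) → Connected G →
    (2≤n : 2 ℕ.≤ n) (σ : Spectrum (laplacian G)) →
    ∀ (diam : ℕ) → IsDiameter G diam →
    let λ₂ = secondSmallest 2≤n σ
        den = ℕ→ℝ n * (ℕ→ℝ (rank G) - 1ℝ) * λ₂
    in Σ[ den#0 ∈ den #0 ] divide (ℕ→ℝ 4) den den#0 ≤ ℕ→ℝ diam
-- With two successors exposed, `fromℕ<` computes and the second smallest eigenvalue is the one at
-- `suc zero`.
theorem9 {ℕ.suc (ℕ.suc n)} G connected (ℕ.s≤s (ℕ.s≤s ℕ.z≤n)) σ diam diameter =
  divide-4≤ diam (ℕ→ℝ (ℕ.suc (ℕ.suc n)) * (ℕ→ℝ (rank G) - 1ℝ) * secondSmallest (ℕ.s≤s (ℕ.s≤s ℕ.z≤n)) σ)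
    (diameter*λ₂≥4 G connected diam diameter σ)
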